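{- For all integers $n\ge 0$ and $i \geq 0$ and all real $x$, the $i$-th derivatives of the Cauchy polynomials can be expressed by $$\frac{d^i c_n(x)}{d x^i} = i! \sum_{m=i}^n (-1)^m c_{n-m} \binom{n}{m} \genfrac{[}{]}{0pt}{}{m}{i}_x$$ and $$\frac{d^i \widehat{c}_n(x)}{d x^i} = (-1)^i i! \sum_{m=i}^n (-1)^m \, \widehat{c}_{n-m} \binom{n}{m}\genfrac{[}{]}{0pt}{}{m}{i}_{ -x}.$$
   Context: For real $z$ and integer $n\ge 0$, $\binom{z}{n} = \frac{z(z-1)\cdots(z-n+1)}{n!}$. The Cauchy polynomials of the first and second kind are $c_n(x) = n! \int_{0}^{1} \binom{t - x}{n}\, dt$ and $\widehat{c}_n(x) = n! \int_{0}^{1} \binom{x - t}{n}\, dt$, $n \ge 0$; the Cauchy numbers are $c_n = c_n(0)$ and $\widehat{c}_n=\widehat{c}_n(0)$. The generalized Stirling numbers of the first kind are $\genfrac{[}{]}{0pt}{}{n}{m}_x = \sum_{i=0}^{n-m} \binom{i+m}{m}\genfrac{[}{]}{0pt}{}{n}{i+m} x^i$ for $0 \leq m \leq n$ and $x\in\mathbb{R}$, where $\genfrac{[}{]}{0pt}{}{n}{m}$ are the unsigned Stirling numbers of the first kind and $x^0=1$. Empty sums (when $i>n$) are $0$. -}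

module Defs where

open import Algebra.Bundles using (CommutativeRing)
open import Algebra.Structures using (IsAbelianGroup; IsRing; IsCommutativeRing)
open import Data.Fin.Base using (toℕ)
open import Data.Integer.Base as ℤ using (ℤ)
open import Data.Maybe.Base using (Maybe; just; nothing)
open import Data.Nat.Base as ℕ using (ℕ; zero; suc; _∸_; _!)
open import Data.Nat.Combinatorics using (_C_)
import Data.Nat.Properties as ℕP
open import Data.Product.Base using (∃; _×_; _,_)
open import Data.Rational.Base as ℚ using (ℚ; 0ℚ; 1ℚ; ½)
import Data.Rational.Properties as ℚP
open import Data.Sum.Base using (inj₁; inj₂)
open import Data.Unit.Base using (⊤)
open import Level using (0ℓ)
open import Relation.Binary.PropositionalEquality.Core as ≡ using (_≡_)
open import Tactic.RingSolver using (solve-∀)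
open import Tactic.RingSolver.Core.AlmostCommutativeRing
  using (AlmostCommutativeRing; fromCommutativeRing)

ℚ-solverRing : AlmostCommutativeRing 0ℓ 0ℓ
ℚ-solverRing = fromCommutativeRing ℚP.+-*-commutativeRing 0≟
  where
  0≟ : ∀ p → Maybe (0ℚ ≡ p)
  0≟ (ℚ.mkℚ (ℤ.+ 0) 0 _) = just ≡.refl
  0≟ _                  = nothing

½-pos : ∀ {ε} → 0ℚ ℚ.< ε → 0ℚ ℚ.< ½ ℚ.* ε
½-pos {ε} ε>0 = ≡.subst (ℚ._< ½ ℚ.* ε) (ℚP.*-zeroʳ ½) (ℚP.*-monoʳ-<-pos ½ ε>0)

½+½ : ∀ ε → ½ ℚ.* ε ℚ.+ ½ ℚ.* ε ≡ ε
½+½ ε = ≡.trans (≡.sym (ℚP.*-distribʳ-+ ε ½ ½)) (ℚP.*-identityˡ ε)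

*-posℚ : ∀ {p q} → 0ℚ ℚ.< p → 0ℚ ℚ.< q → 0ℚ ℚ.< p ℚ.* q
*-posℚ {p} {q} p>0 q>0 =
  ≡.subst (ℚ._< p ℚ.* q) (ℚP.*-zeroʳ p) (ℚP.*-monoʳ-<-pos p {{ℚ.positive p>0}} q>0)

opaque
  divide : ∀ A ε → 0ℚ ℚ.< A → 0ℚ ℚ.< ε → ∃ λ δ → 0ℚ ℚ.< δ × A ℚ.* δ ≡ ε
  divide A ε A>0 ε>0 = ℚ.1/ A ℚ.* ε , *-posℚ (ℚP.positive⁻¹ (ℚ.1/ A) {{ℚP.1/pos⇒pos A}}) ε>0 , eq
    where
    instance
      A-pos : ℚ.Positive A
      A-pos = ℚ.positive A>0
      A-nz : ℚ.NonZero A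
      A-nz = ℚP.pos⇒nonZero A
    eq : A ℚ.* (ℚ.1/ A ℚ.* ε) ≡ ε
    eq = ≡.trans (≡.sym (ℚP.*-assoc A (ℚ.1/ A) ε))
           (≡.trans (≡.cong (ℚ._* ε) (ℚP.*-inverseʳ A)) (ℚP.*-identityˡ ε))

p≤∣p∣ : ∀ p → p ℚ.≤ ℚ.∣ p ∣
p≤∣p∣ p with ℚP.≤-total 0ℚ p
... | inj₁ 0≤p = ℚP.≤-reflexive (≡.sym (ℚP.0≤p⇒∣p∣≡p 0≤p))
... | inj₂ p≤0 = ℚP.≤-trans p≤0 (ℚP.0≤∣p∣ p)

∣p∣≤ : ∀ {p e} → p ℚ.≤ e → ℚ.- p ℚ.≤ e → ℚ.∣ p ∣ ℚ.≤ e
∣p∣≤ {p} {e} p≤e -p≤e with ℚP.∣p∣≡p∨∣p∣≡-p p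
... | inj₁ eq = ≡.subst (ℚ._≤ e) (≡.sym eq) p≤e
... | inj₂ eq = ≡.subst (ℚ._≤ e) (≡.sym eq) -p≤e

∣-∣-comm : ∀ p q → ℚ.∣ p ℚ.- q ∣ ≡ ℚ.∣ q ℚ.- p ∣
∣-∣-comm p q = ≡.trans (≡.sym (ℚP.∣-p∣≡∣p∣ (p ℚ.- q))) (≡.cong ℚ.∣_∣ (eq p q))
  where
  eq : ∀ p q → ℚ.- (p ℚ.- q) ≡ q ℚ.- p
  eq = solve-∀ ℚ-solverRing

≤-shift : ∀ a b → ℚ.∣ a ∣ ℚ.≤ ℚ.∣ b ∣ ℚ.+ ℚ.∣ a ℚ.- b ∣
≤-shift a b = ≡.subst (λ u → ℚ.∣ u ∣ ℚ.≤ ℚ.∣ b ∣ ℚ.+ ℚ.∣ a ℚ.- b ∣) (eq a b) (ℚP.∣p+q∣≤∣p∣+∣q∣ b (a ℚ.- b))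
  where
  eq : ∀ a b → b ℚ.+ (a ℚ.- b) ≡ a
  eq = solve-∀ ℚ-solverRing

∣∣-∣∣ : ∀ a b → ℚ.∣ ℚ.∣ a ∣ ℚ.- ℚ.∣ b ∣ ∣ ℚ.≤ ℚ.∣ a ℚ.- b ∣
∣∣-∣∣ a b = ∣p∣≤ (half a b)
  (≡.subst₂ ℚ._≤_ (eq ℚ.∣ a ∣ ℚ.∣ b ∣) (∣-∣-comm b a) (half b a))
  where
  eq : ∀ p q → q ℚ.- p ≡ ℚ.- (p ℚ.- q)
  eq = solve-∀ ℚ-solverRing
  eq′ : ∀ p q → p ℚ.+ q ℚ.- p ≡ q
  eq′ = solve-∀ ℚ-solverRing
  half : ∀ a b → ℚ.∣ a ∣ ℚ.- ℚ.∣ b ∣ ℚ.≤ ℚ.∣ a ℚ.- b ∣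
  half a b = ≡.subst (ℚ.∣ a ∣ ℚ.- ℚ.∣ b ∣ ℚ.≤_) (eq′ ℚ.∣ b ∣ ℚ.∣ a ℚ.- b ∣)
    (ℚP.+-monoˡ-≤ (ℚ.- ℚ.∣ b ∣) (≤-shift a b))

dist-+ : ∀ {a a′ b b′ ε} → ℚ.∣ a ℚ.- a′ ∣ ℚ.< ½ ℚ.* ε → ℚ.∣ b ℚ.- b′ ∣ ℚ.< ½ ℚ.* ε →
         ℚ.∣ (a ℚ.+ b) ℚ.- (a′ ℚ.+ b′) ∣ ℚ.< ε
dist-+ {a} {a′} {b} {b′} {ε} p q = begin-strict
  ℚ.∣ (a ℚ.+ b) ℚ.- (a′ ℚ.+ b′) ∣          ≡⟨ ≡.cong ℚ.∣_∣ (eq a a′ b b′) ⟩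
  ℚ.∣ (a ℚ.- a′) ℚ.+ (b ℚ.- b′) ∣          ≤⟨ ℚP.∣p+q∣≤∣p∣+∣q∣ (a ℚ.- a′) (b ℚ.- b′) ⟩
  ℚ.∣ a ℚ.- a′ ∣ ℚ.+ ℚ.∣ b ℚ.- b′ ∣        <⟨ ℚP.+-mono-< p q ⟩
  ½ ℚ.* ε ℚ.+ ½ ℚ.* ε                      ≡⟨ ½+½ ε ⟩
  ε                                        ∎
  where
  open ℚP.≤-Reasoning
  eq : ∀ a a′ b b′ → (a ℚ.+ b) ℚ.- (a′ ℚ.+ b′) ≡ (a ℚ.- a′) ℚ.+ (b ℚ.- b′)
  eq = solve-∀ ℚ-solverRing

dist-- : ∀ {a a′ ε} → ℚ.∣ a ℚ.- a′ ∣ ℚ.< ε → ℚ.∣ (ℚ.- a) ℚ.- (ℚ.- a′) ∣ ℚ.< ε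
dist-- {a} {a′} {ε} p = ≡.subst (ℚ._< ε)
  (≡.trans (≡.sym (ℚP.∣-p∣≡∣p∣ (a ℚ.- a′))) (≡.cong ℚ.∣_∣ (eq a a′))) p
  where
  eq : ∀ a a′ → ℚ.- (a ℚ.- a′) ≡ (ℚ.- a) ℚ.- (ℚ.- a′)
  eq = solve-∀ ℚ-solverRing

∣*∣-< : ∀ {a b A δ} → 0ℚ ℚ.< A → ℚ.∣ a ∣ ℚ.< A → ℚ.∣ b ∣ ℚ.< δ → ℚ.∣ a ℚ.* b ∣ ℚ.< A ℚ.* δ
∣*∣-< {a} {b} {A} {δ} A>0 a<A b<δ = begin-strict
  ℚ.∣ a ℚ.* b ∣         ≡⟨ ℚP.∣p*q∣≡∣p∣*∣q∣ a b ⟩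
  ℚ.∣ a ∣ ℚ.* ℚ.∣ b ∣   ≤⟨ ℚP.*-monoʳ-≤-nonNeg ℚ.∣ b ∣ {{ℚP.∣-∣-nonNeg b}} (ℚP.<⇒≤ a<A) ⟩
  A ℚ.* ℚ.∣ b ∣         <⟨ ℚP.*-monoʳ-<-pos A {{ℚ.positive A>0}} b<δ ⟩
  A ℚ.* δ               ∎
  where open ℚP.≤-Reasoning

dist-* : ∀ {a a′ b b′ A B δ δ′ ε} → 0ℚ ℚ.< A → 0ℚ ℚ.< B → B ℚ.* δ ≡ ½ ℚ.* ε → A ℚ.* δ′ ≡ ½ ℚ.* ε →
         ℚ.∣ a ∣ ℚ.< A → ℚ.∣ b′ ∣ ℚ.< B → ℚ.∣ a ℚ.- a′ ∣ ℚ.< δ → ℚ.∣ b ℚ.- b′ ∣ ℚ.< δ′ →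
         ℚ.∣ (a ℚ.* b) ℚ.- (a′ ℚ.* b′) ∣ ℚ.< ε
dist-* {a} {a′} {b} {b′} {A} {B} {δ} {δ′} {ε} A>0 B>0 Bδ Aδ′ a<A b′<B p q = begin-strict
  ℚ.∣ (a ℚ.* b) ℚ.- (a′ ℚ.* b′) ∣                                ≡⟨ ≡.cong ℚ.∣_∣ (eq a a′ b b′) ⟩
  ℚ.∣ a ℚ.* (b ℚ.- b′) ℚ.+ b′ ℚ.* (a ℚ.- a′) ∣                   ≤⟨ ℚP.∣p+q∣≤∣p∣+∣q∣ (a ℚ.* (b ℚ.- b′)) (b′ ℚ.* (a ℚ.- a′)) ⟩
  ℚ.∣ a ℚ.* (b ℚ.- b′) ∣ ℚ.+ ℚ.∣ b′ ℚ.* (a ℚ.- a′) ∣             <⟨ ℚP.+-mono-< (∣*∣-< {a} {b ℚ.- b′} A>0 a<A q) (∣*∣-< {b′} {a ℚ.- a′} B>0 b′<B p) ⟩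
  A ℚ.* δ′ ℚ.+ B ℚ.* δ                                           ≡⟨ ≡.cong₂ ℚ._+_ Aδ′ Bδ ⟩
  ½ ℚ.* ε ℚ.+ ½ ℚ.* ε                                            ≡⟨ ½+½ ε ⟩
  ε                                                              ∎
  where
  open ℚP.≤-Reasoning
  eq : ∀ a a′ b b′ → (a ℚ.* b) ℚ.- (a′ ℚ.* b′) ≡ a ℚ.* (b ℚ.- b′) ℚ.+ b′ ℚ.* (a ℚ.- a′)
  eq = solve-∀ ℚ-solverRing

IsCauchy : (ℕ → ℚ) → Set
IsCauchy s = ∀ ε → 0ℚ ℚ.< ε →
  ∃ λ N → ∀ m n → N ℕ.≤ m → N ℕ.≤ n → ℚ.∣ s m ℚ.- s n ∣ ℚ.< ε

Eventually : (ℕ → Set) → Set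
Eventually P = ∃ λ N → ∀ n → N ℕ.≤ n → P n

always : ∀ {P : ℕ → Set} → (∀ n → P n) → Eventually P
always p = 0 , λ n _ → p n

ev-map : ∀ {P Q : ℕ → Set} → (∀ n → P n → Q n) → Eventually P → Eventually Q
ev-map f (N , p) = N , λ n N≤n → f n (p n N≤n)

ev-zip : ∀ {P Q R : ℕ → Set} → (∀ n → P n → Q n → R n) → Eventually P → Eventually Q → Eventually R
ev-zip f (M , p) (N , q) = M ℕ.⊔ N , λ n h →
  f n (p n (ℕP.m⊔n≤o⇒m≤o M N h)) (q n (ℕP.m⊔n≤o⇒n≤o M N h))

-- A real number is a Cauchy sequence of rationals; the equality of reals is the
-- setoid relation _≈_ (the difference is a null sequence), not _≡_.
record ℝ : Set where
  constructor mkℝ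
  field
    seq    : ℕ → ℚ
    cauchy : IsCauchy seq

open ℝ public

infix 4 _≈_ _≤_ _<_

record _≈_ (x y : ℝ) : Set where
  constructor mk≈
  field close : ∀ ε → 0ℚ ℚ.< ε → Eventually λ n → ℚ.∣ seq x n ℚ.- seq y n ∣ ℚ.< ε

open _≈_ public

record _≤_ (x y : ℝ) : Set where
  constructor mk≤
  field almost : ∀ ε → 0ℚ ℚ.< ε → Eventually λ n → seq x n ℚ.≤ seq y n ℚ.+ ε

open _≤_ public

opaque
  bounded : ∀ s → IsCauchy s → ∃ λ A → 0ℚ ℚ.< A × Eventually λ n → ℚ.∣ s n ∣ ℚ.< A
  bounded s c with c 1ℚ (ℚP.positive⁻¹ 1ℚ)
  ... | N , h = ℚ.∣ s N ∣ ℚ.+ 1ℚ , pos , N , λ n N≤n →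
      ℚP.≤-<-trans (≤-shift (s n) (s N)) (ℚP.+-monoʳ-< ℚ.∣ s N ∣ (h n N N≤n ℕP.≤-refl))
    where
    pos : 0ℚ ℚ.< ℚ.∣ s N ∣ ℚ.+ 1ℚ
    pos = ℚP.≤-<-trans (ℚP.0≤∣p∣ (s N))
      (≡.subst (ℚ._< ℚ.∣ s N ∣ ℚ.+ 1ℚ) (ℚP.+-identityʳ ℚ.∣ s N ∣)
        (ℚP.+-monoʳ-< ℚ.∣ s N ∣ (ℚP.positive⁻¹ 1ℚ)))

  const-cauchy : ∀ q → IsCauchy (λ _ → q)
  const-cauchy q ε ε>0 = 0 , λ _ _ _ _ → ≡.subst (λ u → ℚ.∣ u ∣ ℚ.< ε) (≡.sym (ℚP.+-inverseʳ q)) ε>0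

  +-cauchy : ∀ s t → IsCauchy s → IsCauchy t → IsCauchy (λ n → s n ℚ.+ t n)
  +-cauchy s t c d ε ε>0 with c (½ ℚ.* ε) (½-pos ε>0) | d (½ ℚ.* ε) (½-pos ε>0)
  ... | M , p | N , q = M ℕ.⊔ N , λ m n hm hn →
    dist-+ {s m} {s n} {t m} {t n}
      (p m n (ℕP.m⊔n≤o⇒m≤o M N hm) (ℕP.m⊔n≤o⇒m≤o M N hn))
      (q m n (ℕP.m⊔n≤o⇒n≤o M N hm) (ℕP.m⊔n≤o⇒n≤o M N hn))

  neg-cauchy : ∀ s → IsCauchy s → IsCauchy (λ n → ℚ.- s n)
  neg-cauchy s c ε ε>0 with c ε ε>0
  ... | M , p = M , λ m n hm hn → dist-- {s m} {s n} (p m n hm hn)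

  abs-cauchy : ∀ s → IsCauchy s → IsCauchy (λ n → ℚ.∣ s n ∣)
  abs-cauchy s c ε ε>0 with c ε ε>0
  ... | M , p = M , λ m n hm hn → ℚP.≤-<-trans (∣∣-∣∣ (s m) (s n)) (p m n hm hn)

  *-cauchy : ∀ s t → IsCauchy s → IsCauchy t → IsCauchy (λ n → s n ℚ.* t n)
  *-cauchy s t c d ε ε>0 = let
      (A , A>0 , K , s<A) = bounded s c
      (B , B>0 , L , t<B) = bounded t d
      (δ , δ>0 , Bδ)      = divide B (½ ℚ.* ε) B>0 (½-pos ε>0)
      (δ′ , δ′>0 , Aδ′)   = divide A (½ ℚ.* ε) A>0 (½-pos ε>0)
      (M , p)             = c δ δ>0
      (N , q)             = d δ′ δ′>0
    in combine {A = A} {B = B} {δ = δ} {δ′ = δ′} A>0 B>0 Bδ Aδ′ {K} {L} {M} {N} s<A t<B p q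
    where
    combine : ∀ {A B δ δ′} → 0ℚ ℚ.< A → 0ℚ ℚ.< B → B ℚ.* δ ≡ ½ ℚ.* ε → A ℚ.* δ′ ≡ ½ ℚ.* ε →
      ∀ {K L M N} → (∀ n → K ℕ.≤ n → ℚ.∣ s n ∣ ℚ.< A) → (∀ n → L ℕ.≤ n → ℚ.∣ t n ∣ ℚ.< B) →
      (∀ m n → M ℕ.≤ m → M ℕ.≤ n → ℚ.∣ s m ℚ.- s n ∣ ℚ.< δ) →
      (∀ m n → N ℕ.≤ m → N ℕ.≤ n → ℚ.∣ t m ℚ.- t n ∣ ℚ.< δ′) →
      ∃ λ N → ∀ m n → N ℕ.≤ m → N ℕ.≤ n → ℚ.∣ s m ℚ.* t m ℚ.- s n ℚ.* t n ∣ ℚ.< ε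
    combine {A} {B} {δ} {δ′} A>0 B>0 Bδ Aδ′ {K} {L} {M} {N} s<A t<B p q =
      (K ℕ.⊔ L) ℕ.⊔ (M ℕ.⊔ N) , λ m n hm hn →
        dist-* {s m} {s n} {t m} {t n} {A} {B} {δ} {δ′} {ε} A>0 B>0 Bδ Aδ′
          (s<A m (ℕP.m⊔n≤o⇒m≤o K L (ℕP.m⊔n≤o⇒m≤o (K ℕ.⊔ L) (M ℕ.⊔ N) hm)))
          (t<B n (ℕP.m⊔n≤o⇒n≤o K L (ℕP.m⊔n≤o⇒m≤o (K ℕ.⊔ L) (M ℕ.⊔ N) hn)))
          (p m n (ℕP.m⊔n≤o⇒m≤o M N (ℕP.m⊔n≤o⇒n≤o (K ℕ.⊔ L) (M ℕ.⊔ N) hm))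
                 (ℕP.m⊔n≤o⇒m≤o M N (ℕP.m⊔n≤o⇒n≤o (K ℕ.⊔ L) (M ℕ.⊔ N) hn)))
          (q m n (ℕP.m⊔n≤o⇒n≤o M N (ℕP.m⊔n≤o⇒n≤o (K ℕ.⊔ L) (M ℕ.⊔ N) hm))
                 (ℕP.m⊔n≤o⇒n≤o M N (ℕP.m⊔n≤o⇒n≤o (K ℕ.⊔ L) (M ℕ.⊔ N) hn)))

infixl 6 _+_ _-_
infixl 7 _*_
infix 8 -_

fromℚ : ℚ → ℝ
seq    (fromℚ q) _ = q
cauchy (fromℚ q)   = const-cauchy q

0ℝ 1ℝ : ℝ
0ℝ = fromℚ 0ℚ
1ℝ = fromℚ 1ℚ

_+_ _*_ : ℝ → ℝ → ℝ
seq    (x + y) n = seq x n ℚ.+ seq y n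
cauchy (x + y)   = +-cauchy (seq x) (seq y) (cauchy x) (cauchy y)
seq    (x * y) n = seq x n ℚ.* seq y n
cauchy (x * y)   = *-cauchy (seq x) (seq y) (cauchy x) (cauchy y)

-_ ∣_∣ : ℝ → ℝ
seq    (- x) n = ℚ.- seq x n
cauchy (- x)   = neg-cauchy (seq x) (cauchy x)
seq    ∣ x ∣ n = ℚ.∣ seq x n ∣
cauchy ∣ x ∣   = abs-cauchy (seq x) (cauchy x)

_-_ : ℝ → ℝ → ℝ
x - y = x + (- y)

record _<_ (x y : ℝ) : Set where
  constructor mk<
  field
    gap     : ℚ
    gap-pos : 0ℚ ℚ.< gap
    gap-≤   : x + fromℚ gap ≤ y

open _<_ public

opaque
  pointwise : ∀ {x y} → (∀ n → seq x n ≡ seq y n) → x ≈ y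
  pointwise {x} {y} eq = mk≈ λ ε ε>0 → always λ n →
    ≡.subst (λ u → ℚ.∣ u ∣ ℚ.< ε)
      (≡.sym (≡.trans (≡.cong (ℚ._- seq y n) (eq n)) (ℚP.+-inverseʳ (seq y n)))) ε>0

  ≈-refl : ∀ {x} → x ≈ x
  ≈-refl = pointwise λ _ → ≡.refl

  ≈-sym : ∀ {x y} → x ≈ y → y ≈ x
  ≈-sym {x} {y} p = mk≈ λ ε ε>0 → ev-map
    (λ n → ≡.subst (ℚ._< ε) (∣-∣-comm (seq x n) (seq y n))) (close p ε ε>0)

  ≈-trans : ∀ {x y z} → x ≈ y → y ≈ z → x ≈ z
  ≈-trans {x} {y} {z} p q = mk≈ λ ε ε>0 → ev-zip
    (λ n h k → ≡.subst (λ u → ℚ.∣ u ∣ ℚ.< ε) (eq (seq x n) (seq y n) (seq z n))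
      (dist-+ {seq x n} {seq y n} {seq y n} {seq z n} h k))
    (close p (½ ℚ.* ε) (½-pos ε>0)) (close q (½ ℚ.* ε) (½-pos ε>0))
    where
    eq : ∀ a b c → (a ℚ.+ b) ℚ.- (b ℚ.+ c) ≡ a ℚ.- c
    eq = solve-∀ ℚ-solverRing

  +-cong : ∀ {x x′ y y′} → x ≈ x′ → y ≈ y′ → x + y ≈ x′ + y′
  +-cong {x} {x′} {y} {y′} p q = mk≈ λ ε ε>0 → ev-zip
    (λ n → dist-+ {seq x n} {seq x′ n} {seq y n} {seq y′ n})
    (close p (½ ℚ.* ε) (½-pos ε>0)) (close q (½ ℚ.* ε) (½-pos ε>0))

  neg-cong : ∀ {x x′} → x ≈ x′ → - x ≈ - x′
  neg-cong {x} {x′} p = mk≈ λ ε ε>0 → ev-map (λ n → dist-- {seq x n} {seq x′ n}) (close p ε ε>0)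

  ∣∣-cong : ∀ {x x′} → x ≈ x′ → ∣ x ∣ ≈ ∣ x′ ∣
  ∣∣-cong {x} {x′} p = mk≈ λ ε ε>0 → ev-map
    (λ n → ℚP.≤-<-trans (∣∣-∣∣ (seq x n) (seq x′ n))) (close p ε ε>0)

  *-cong : ∀ {x x′ y y′} → x ≈ x′ → y ≈ y′ → x * y ≈ x′ * y′
  *-cong {x} {x′} {y} {y′} p q = mk≈ λ ε ε>0 → let
      (A , A>0 , x<A)   = bounded (seq x) (cauchy x)
      (B , B>0 , y′<B)  = bounded (seq y′) (cauchy y′)
      (δ , δ>0 , Bδ)    = divide B (½ ℚ.* ε) B>0 (½-pos ε>0)
      (δ′ , δ′>0 , Aδ′) = divide A (½ ℚ.* ε) A>0 (½-pos ε>0)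
    in combine {A} {B} {δ} {δ′} {ε} A>0 B>0 Bδ Aδ′ x<A y′<B (close p δ δ>0) (close q δ′ δ′>0)
    where
    combine : ∀ {A B δ δ′ ε} → 0ℚ ℚ.< A → 0ℚ ℚ.< B → B ℚ.* δ ≡ ½ ℚ.* ε → A ℚ.* δ′ ≡ ½ ℚ.* ε →
      Eventually (λ n → ℚ.∣ seq x n ∣ ℚ.< A) → Eventually (λ n → ℚ.∣ seq y′ n ∣ ℚ.< B) →
      Eventually (λ n → ℚ.∣ seq x n ℚ.- seq x′ n ∣ ℚ.< δ) →
      Eventually (λ n → ℚ.∣ seq y n ℚ.- seq y′ n ∣ ℚ.< δ′) →
      Eventually (λ n → ℚ.∣ seq x n ℚ.* seq y n ℚ.- seq x′ n ℚ.* seq y′ n ∣ ℚ.< ε)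
    combine {A} {B} {δ} {δ′} {ε} A>0 B>0 Bδ Aδ′ x<A y′<B p q = ev-zip
      (λ n (a , b) (c , d) → dist-* {seq x n} {seq x′ n} {seq y n} {seq y′ n} {A} {B} {δ} {δ′} {ε}
        A>0 B>0 Bδ Aδ′ a b c d)
      (ev-zip (λ _ → _,_) x<A y′<B) (ev-zip (λ _ → _,_) p q)

  +-assoc : ∀ x y z → (x + y) + z ≈ x + (y + z)
  +-assoc x y z = pointwise λ n → ℚP.+-assoc (seq x n) (seq y n) (seq z n)

  +-comm : ∀ x y → x + y ≈ y + x
  +-comm x y = pointwise λ n → ℚP.+-comm (seq x n) (seq y n)

  +-identityˡ : ∀ x → 0ℝ + x ≈ x
  +-identityˡ x = pointwise λ n → ℚP.+-identityˡ (seq x n)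

  +-identityʳ : ∀ x → x + 0ℝ ≈ x
  +-identityʳ x = pointwise λ n → ℚP.+-identityʳ (seq x n)

  +-inverseˡ : ∀ x → (- x) + x ≈ 0ℝ
  +-inverseˡ x = pointwise λ n → ℚP.+-inverseˡ (seq x n)

  +-inverseʳ : ∀ x → x + (- x) ≈ 0ℝ
  +-inverseʳ x = pointwise λ n → ℚP.+-inverseʳ (seq x n)

  *-assoc : ∀ x y z → (x * y) * z ≈ x * (y * z)
  *-assoc x y z = pointwise λ n → ℚP.*-assoc (seq x n) (seq y n) (seq z n)

  *-comm : ∀ x y → x * y ≈ y * x
  *-comm x y = pointwise λ n → ℚP.*-comm (seq x n) (seq y n)

  *-identityˡ : ∀ x → 1ℝ * x ≈ x
  *-identityˡ x = pointwise λ n → ℚP.*-identityˡ (seq x n)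

  *-identityʳ : ∀ x → x * 1ℝ ≈ x
  *-identityʳ x = pointwise λ n → ℚP.*-identityʳ (seq x n)

  *-distribˡ-+ : ∀ x y z → x * (y + z) ≈ x * y + x * z
  *-distribˡ-+ x y z = pointwise λ n → ℚP.*-distribˡ-+ (seq x n) (seq y n) (seq z n)

  *-distribʳ-+ : ∀ x y z → (y + z) * x ≈ y * x + z * x
  *-distribʳ-+ x y z = pointwise λ n → ℚP.*-distribʳ-+ (seq x n) (seq y n) (seq z n)

+-isAbelianGroup : IsAbelianGroup _≈_ _+_ 0ℝ (-_)
+-isAbelianGroup = record
  { isGroup = record
    { isMonoid = record
      { isSemigroup = record
        { isMagma = record
          { isEquivalence = record { refl = ≈-refl ; sym = ≈-sym ; trans = ≈-trans }
          ; ∙-cong = +-cong }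
        ; assoc = +-assoc }
      ; identity = +-identityˡ , +-identityʳ }
    ; inverse = +-inverseˡ , +-inverseʳ
    ; ⁻¹-cong = neg-cong }
  ; comm = +-comm }

+-*-isRing : IsRing _≈_ _+_ _*_ (-_) 0ℝ 1ℝ
+-*-isRing = record
  { +-isAbelianGroup = +-isAbelianGroup
  ; *-cong = *-cong
  ; *-assoc = *-assoc
  ; *-identity = *-identityˡ , *-identityʳ
  ; distrib = *-distribˡ-+ , *-distribʳ-+ }

ℝ-isCommutativeRing : IsCommutativeRing _≈_ _+_ _*_ (-_) 0ℝ 1ℝ
ℝ-isCommutativeRing = record { isRing = +-*-isRing ; *-comm = *-comm }

ℝ-commutativeRing : CommutativeRing 0ℓ 0ℓ
ℝ-commutativeRing = record { isCommutativeRing = ℝ-isCommutativeRing }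

--

module ℝ-Ring = CommutativeRing ℝ-commutativeRing

opaque
  pointwise-≤ : ∀ {x y} → (∀ n → seq x n ℚ.≤ seq y n) → x ≤ y
  pointwise-≤ {x} {y} le = mk≤ λ ε ε>0 → always λ n → begin
    seq x n             ≤⟨ le n ⟩
    seq y n             ≡⟨ ℚP.+-identityʳ (seq y n) ⟨
    seq y n ℚ.+ 0ℚ      ≤⟨ ℚP.+-monoʳ-≤ (seq y n) (ℚP.<⇒≤ ε>0) ⟩
    seq y n ℚ.+ ε       ∎
    where open ℚP.≤-Reasoning

  ≤-reflexive : ∀ {x y} → x ≈ y → x ≤ y
  ≤-reflexive {x} {y} p = mk≤ λ ε ε>0 → ev-map (λ n h → begin
    seq x n                                ≡⟨ eq (seq x n) (seq y n) ⟩
    seq y n ℚ.+ (seq x n ℚ.- seq y n)      ≤⟨ ℚP.+-monoʳ-≤ (seq y n) (p≤∣p∣ (seq x n ℚ.- seq y n)) ⟩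
    seq y n ℚ.+ ℚ.∣ seq x n ℚ.- seq y n ∣  ≤⟨ ℚP.+-monoʳ-≤ (seq y n) (ℚP.<⇒≤ h) ⟩
    seq y n ℚ.+ ε                          ∎) (close p ε ε>0)
    where
    open ℚP.≤-Reasoning
    eq : ∀ a b → a ≡ b ℚ.+ (a ℚ.- b)
    eq = solve-∀ ℚ-solverRing

  ≤-trans : ∀ {x y z} → x ≤ y → y ≤ z → x ≤ z
  ≤-trans {x} {y} {z} p q = mk≤ λ ε ε>0 → ev-zip (λ n h k → begin
    seq x n                                ≤⟨ h ⟩
    seq y n ℚ.+ ½ ℚ.* ε                    ≤⟨ ℚP.+-monoˡ-≤ (½ ℚ.* ε) k ⟩
    (seq z n ℚ.+ ½ ℚ.* ε) ℚ.+ ½ ℚ.* ε      ≡⟨ ℚP.+-assoc (seq z n) (½ ℚ.* ε) (½ ℚ.* ε) ⟩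
    seq z n ℚ.+ (½ ℚ.* ε ℚ.+ ½ ℚ.* ε)      ≡⟨ ≡.cong (seq z n ℚ.+_) (½+½ ε) ⟩
    seq z n ℚ.+ ε                          ∎)
    (almost p (½ ℚ.* ε) (½-pos ε>0)) (almost q (½ ℚ.* ε) (½-pos ε>0))
    where open ℚP.≤-Reasoning

  +-mono-≤ : ∀ {x x′ y y′} → x ≤ x′ → y ≤ y′ → x + y ≤ x′ + y′
  +-mono-≤ {x} {x′} {y} {y′} p q = mk≤ λ ε ε>0 → ev-zip (λ n h k → begin
    seq x n ℚ.+ seq y n                                          ≤⟨ ℚP.+-mono-≤ h k ⟩
    (seq x′ n ℚ.+ ½ ℚ.* ε) ℚ.+ (seq y′ n ℚ.+ ½ ℚ.* ε)            ≡⟨ eq (seq x′ n) (seq y′ n) (½ ℚ.* ε) ⟩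
    (seq x′ n ℚ.+ seq y′ n) ℚ.+ (½ ℚ.* ε ℚ.+ ½ ℚ.* ε)            ≡⟨ ≡.cong (seq x′ n ℚ.+ seq y′ n ℚ.+_) (½+½ ε) ⟩
    (seq x′ n ℚ.+ seq y′ n) ℚ.+ ε                                ∎)
    (almost p (½ ℚ.* ε) (½-pos ε>0)) (almost q (½ ℚ.* ε) (½-pos ε>0))
    where
    open ℚP.≤-Reasoning
    eq : ∀ a b e → (a ℚ.+ e) ℚ.+ (b ℚ.+ e) ≡ (a ℚ.+ b) ℚ.+ (e ℚ.+ e)
    eq = solve-∀ ℚ-solverRing

  ∣x∣≤ : ∀ {x e} → x ≤ e → - x ≤ e → ∣ x ∣ ≤ e
  ∣x∣≤ p q = mk≤ λ ε ε>0 → ev-zip (λ _ → ∣p∣≤) (almost p ε ε>0) (almost q ε ε>0)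

  ∣+∣≤ : ∀ x y → ∣ x + y ∣ ≤ ∣ x ∣ + ∣ y ∣
  ∣+∣≤ x y = pointwise-≤ λ n → ℚP.∣p+q∣≤∣p∣+∣q∣ (seq x n) (seq y n)

  ∣*∣ : ∀ x y → ∣ x * y ∣ ≈ ∣ x ∣ * ∣ y ∣
  ∣*∣ x y = pointwise λ n → ℚP.∣p*q∣≡∣p∣*∣q∣ (seq x n) (seq y n)

  0≤∣x∣ : ∀ x → 0ℝ ≤ ∣ x ∣
  0≤∣x∣ x = pointwise-≤ λ n → ℚP.0≤∣p∣ (seq x n)

  fromℚ-mono-≤ : ∀ {p q} → p ℚ.≤ q → fromℚ p ≤ fromℚ q
  fromℚ-mono-≤ p≤q = pointwise-≤ λ _ → p≤q

  fromℚ-pos : ∀ {q} → 0ℚ ℚ.< q → 0ℝ < fromℚ q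
  fromℚ-pos {q} q>0 = mk< q q>0 (≤-reflexive (pointwise λ _ → ℚP.+-identityˡ q))

  below : ∀ {ε} → 0ℝ < ε → ∃ λ q → 0ℚ ℚ.< q × fromℚ q ≤ ε
  below (mk< q q>0 le) = q , q>0 , ≤-trans (≤-reflexive (pointwise λ _ → ≡.sym (ℚP.+-identityˡ q))) le

  above : ∀ x → ∃ λ q → 0ℚ ℚ.< q × ∣ x ∣ ≤ fromℚ q
  above x with bounded (seq x) (cauchy x)
  ... | q , q>0 , h = q , q>0 , mk≤ λ ε ε>0 → ev-map (λ n k → begin
    ℚ.∣ seq x n ∣  ≤⟨ ℚP.<⇒≤ k ⟩
    q              ≡⟨ ℚP.+-identityʳ q ⟨
    q ℚ.+ 0ℚ       ≤⟨ ℚP.+-monoʳ-≤ q (ℚP.<⇒≤ ε>0) ⟩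
    q ℚ.+ ε        ∎) h
    where open ℚP.≤-Reasoning

  *-nonNeg : ∀ {x y} → 0ℝ ≤ x → 0ℝ ≤ y → 0ℝ ≤ x * y
  *-nonNeg {x} {y} p q = mk≤ λ ε ε>0 → let
      (A , A>0 , x<A)   = bounded (seq x) (cauchy x)
      (B , B>0 , y<B)   = bounded (seq y) (cauchy y)
      (δ , δ>0 , Bδ)    = divide B (½ ℚ.* ε) B>0 (½-pos ε>0)
      A+δ>0             = ℚP.+-mono-< A>0 δ>0
      (δ′ , δ′>0 , Aδ′) = divide (A ℚ.+ δ) (½ ℚ.* ε) A+δ>0 (½-pos ε>0)
    in ev-zip (λ n (a , b) (c , d) →
         core (seq x n) (seq y n) A B δ δ′ ε a b c d δ>0 δ′>0 Bδ Aδ′)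
       (ev-zip (λ _ → _,_) x<A y<B)
       (ev-zip (λ _ → _,_) (almost p δ δ>0) (almost q δ′ δ′>0))
    where
    open ℚP.≤-Reasoning
    eq : ∀ a b d e → (a ℚ.+ d) ℚ.* (b ℚ.+ e) ≡ a ℚ.* b ℚ.+ (b ℚ.* d ℚ.+ (a ℚ.+ d) ℚ.* e)
    eq = solve-∀ ℚ-solverRing
    core : ∀ a b A B δ δ′ ε → ℚ.∣ a ∣ ℚ.< A → ℚ.∣ b ∣ ℚ.< B → 0ℚ ℚ.≤ a ℚ.+ δ → 0ℚ ℚ.≤ b ℚ.+ δ′ →
      0ℚ ℚ.< δ → 0ℚ ℚ.< δ′ → B ℚ.* δ ≡ ½ ℚ.* ε → (A ℚ.+ δ) ℚ.* δ′ ≡ ½ ℚ.* ε → 0ℚ ℚ.≤ a ℚ.* b ℚ.+ ε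
    core a b A B δ δ′ ε a<A b<B pa pb δ>0 δ′>0 Bδ Aδ′ = begin
      0ℚ                                                  ≡⟨ ℚP.*-zeroʳ (a ℚ.+ δ) ⟨
      (a ℚ.+ δ) ℚ.* 0ℚ                                    ≤⟨ ℚP.*-monoˡ-≤-nonNeg (a ℚ.+ δ) {{ℚ.nonNegative pa}} pb ⟩
      (a ℚ.+ δ) ℚ.* (b ℚ.+ δ′)                            ≡⟨ eq a b δ δ′ ⟩
      a ℚ.* b ℚ.+ (b ℚ.* δ ℚ.+ (a ℚ.+ δ) ℚ.* δ′)          ≤⟨ ℚP.+-monoʳ-≤ (a ℚ.* b) (ℚP.+-mono-≤
        (ℚP.*-monoʳ-≤-nonNeg δ {{ℚ.nonNegative (ℚP.<⇒≤ δ>0)}} (ℚP.≤-trans (p≤∣p∣ b) (ℚP.<⇒≤ b<B)))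
        (ℚP.*-monoʳ-≤-nonNeg δ′ {{ℚ.nonNegative (ℚP.<⇒≤ δ′>0)}}
          (ℚP.+-monoˡ-≤ δ (ℚP.≤-trans (p≤∣p∣ a) (ℚP.<⇒≤ a<A))))) ⟩
      a ℚ.* b ℚ.+ (B ℚ.* δ ℚ.+ (A ℚ.+ δ) ℚ.* δ′)          ≡⟨ ≡.cong (a ℚ.* b ℚ.+_) (≡.trans (≡.cong₂ ℚ._+_ Bδ Aδ′) (½+½ ε)) ⟩
      a ℚ.* b ℚ.+ ε                                       ∎

  ≤-refl : ∀ {x} → x ≤ x
  ≤-refl = ≤-reflexive ≈-refl

  0≤y-x : ∀ {x y} → x ≤ y → 0ℝ ≤ y - x
  0≤y-x {x} {y} p = ≤-trans (≤-reflexive (pointwise λ n → ≡.sym (ℚP.+-inverseʳ (seq x n))))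
    (+-mono-≤ p ≤-refl)

  0≤y-x⁻¹ : ∀ {x y} → 0ℝ ≤ y - x → x ≤ y
  0≤y-x⁻¹ {x} {y} p = ≤-trans (≤-reflexive (pointwise λ n → ≡.sym (ℚP.+-identityˡ (seq x n))))
    (≤-trans (+-mono-≤ p (≤-refl {x})) (≤-reflexive (pointwise λ n → eq (seq x n) (seq y n))))
    where
    eq : ∀ a b → (b ℚ.- a) ℚ.+ a ≡ b
    eq = solve-∀ ℚ-solverRing

  *-monoˡ-≤ : ∀ {c x y} → 0ℝ ≤ c → x ≤ y → c * x ≤ c * y
  *-monoˡ-≤ {c} {x} {y} 0≤c x≤y = 0≤y-x⁻¹ (≤-trans (*-nonNeg 0≤c (0≤y-x x≤y))
    (≤-reflexive (pointwise λ n → eq (seq c n) (seq x n) (seq y n))))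
    where
    eq : ∀ c a b → c ℚ.* (b ℚ.- a) ≡ c ℚ.* b ℚ.- c ℚ.* a
    eq = solve-∀ ℚ-solverRing

  *-monoʳ-≤ : ∀ {c x y} → 0ℝ ≤ c → x ≤ y → x * c ≤ y * c
  *-monoʳ-≤ {c} {x} {y} 0≤c x≤y = ≤-trans (≤-reflexive (ℝ-Ring.*-comm x c))
    (≤-trans (*-monoˡ-≤ 0≤c x≤y) (≤-reflexive (ℝ-Ring.*-comm c y)))

  *-mono-≤ : ∀ {x x′ y y′} → 0ℝ ≤ x → 0ℝ ≤ y′ → x ≤ x′ → y ≤ y′ → x * y ≤ x′ * y′
  *-mono-≤ 0≤x 0≤y′ p q = ≤-trans (*-monoˡ-≤ 0≤x q) (*-monoʳ-≤ 0≤y′ p)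

  neg-anti-≤ : ∀ {x y} → x ≤ y → - y ≤ - x
  neg-anti-≤ {x} {y} p = 0≤y-x⁻¹ (≤-trans (0≤y-x p)
    (≤-reflexive (pointwise λ n → eq (seq x n) (seq y n))))
    where
    eq : ∀ a b → b ℚ.- a ≡ (ℚ.- a) ℚ.- (ℚ.- b)
    eq = solve-∀ ℚ-solverRing

  between : ∀ {a b u v} → a ≤ u → u ≤ b → a ≤ v → v ≤ b → ∣ u - v ∣ ≤ b - a
  between {a} {b} {u} {v} a≤u u≤b a≤v v≤b = ∣x∣≤ (+-mono-≤ u≤b (neg-anti-≤ a≤v))
    (≤-trans (≤-reflexive (pointwise λ n → eq (seq u n) (seq v n))) (+-mono-≤ v≤b (neg-anti-≤ a≤u)))
    where
    eq : ∀ a b → ℚ.- (a ℚ.- b) ≡ b ℚ.- a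
    eq = solve-∀ ℚ-solverRing

open import Algebra.Properties.Semiring.Exp ℝ-Ring.semiring public using (_^_; ^-congˡ)
open import Algebra.Properties.Semiring.Mult ℝ-Ring.semiring public using () renaming (_×_ to _·_)
open import Algebra.Properties.Semiring.Sum ℝ-Ring.semiring public using (sum)

fromℕ : ℕ → ℝ
fromℕ n = n · 1ℝ

-- In a tagged partition of [a, b], `step ξ p` is the leftmost interval [a, p]
-- with tag ξ.
data TaggedPartition : ℝ → ℝ → Set where
  done : ∀ {a b} → a ≈ b → TaggedPartition a b
  step : ∀ {a b} (ξ p : ℝ) → a ≤ ξ → ξ ≤ p → TaggedPartition p b → TaggedPartition a b

MeshAtMost : ℝ → ∀ {a b} → TaggedPartition a b → Set
MeshAtMost δ     (done _)           = ⊤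
MeshAtMost δ {a} (step ξ p _ _ P) = (p - a ≤ δ) × MeshAtMost δ P

riemannSum : (ℝ → ℝ) → ∀ {a b} → TaggedPartition a b → ℝ
riemannSum f     (done _)           = 0ℝ
riemannSum f {a} (step ξ p _ _ P) = f ξ * (p - a) + riemannSum f P

HasIntegral : (ℝ → ℝ) → ℝ → ℝ → ℝ → Set
HasIntegral f a b I = ∀ ε → 0ℝ < ε → ∃ λ δ → 0ℝ < δ ×
  (∀ (P : TaggedPartition a b) → MeshAtMost δ P → ∣ riemannSum f P - I ∣ ≤ ε)

Integrable : (ℝ → ℝ) → ℝ → ℝ → Set
Integrable f a b = ∃ λ I → HasIntegral f a b I

-- For a ≤ b the value I is determined up to _≈_ by f, a and b; for b < a there is
-- no partition, so ∫ is only meant for a ≤ b.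
∫ : ∀ f a b → Integrable f a b → ℝ
∫ f a b (I , _) = I

mesh-≤ : ∀ {δ δ′ a b} → δ ≤ δ′ → (P : TaggedPartition a b) → MeshAtMost δ P → MeshAtMost δ′ P
mesh-≤ δ≤δ′ (done _)         _       = _
mesh-≤ δ≤δ′ (step ξ p _ _ P) (h , m) = ≤-trans h δ≤δ′ , mesh-≤ δ≤δ′ P m

opaque
  riemannSum-cong : ∀ {f g} → (∀ t → f t ≈ g t) → ∀ {a b} (P : TaggedPartition a b) →
                    riemannSum f P ≈ riemannSum g P
  riemannSum-cong fg (done _)         = ≈-refl
  riemannSum-cong fg (step ξ p _ _ P) = +-cong (*-cong (fg ξ) ≈-refl) (riemannSum-cong fg P)

  riemannSum-+ : ∀ f g {a b} (P : TaggedPartition a b) →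
                 riemannSum (λ t → f t + g t) P ≈ riemannSum f P + riemannSum g P
  riemannSum-+ f g (done _) = pointwise λ _ → ≡.refl
  riemannSum-+ f g {a} (step ξ p _ _ P) = ≈-trans (+-cong ≈-refl (riemannSum-+ f g P))
    (pointwise λ n → eq (seq (f ξ) n) (seq (g ξ) n) (seq (p - a) n) (seq (riemannSum f P) n) (seq (riemannSum g P) n))
    where
    eq : ∀ u v w s t → (u ℚ.+ v) ℚ.* w ℚ.+ (s ℚ.+ t) ≡ (u ℚ.* w ℚ.+ s) ℚ.+ (v ℚ.* w ℚ.+ t)
    eq = solve-∀ ℚ-solverRing

  riemannSum-* : ∀ c f {a b} (P : TaggedPartition a b) →
                 riemannSum (λ t → c * f t) P ≈ c * riemannSum f P
  riemannSum-* c f (done _) = pointwise λ n → ≡.sym (ℚP.*-zeroʳ (seq c n))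
  riemannSum-* c f {a} (step ξ p _ _ P) = ≈-trans (+-cong ≈-refl (riemannSum-* c f P))
    (pointwise λ n → eq (seq c n) (seq (f ξ) n) (seq (p - a) n) (seq (riemannSum f P) n))
    where
    eq : ∀ c u w s → (c ℚ.* u) ℚ.* w ℚ.+ c ℚ.* s ≡ c ℚ.* (u ℚ.* w ℚ.+ s)
    eq = solve-∀ ℚ-solverRing

  integral-cong : ∀ {f g a b I} → (∀ t → f t ≈ g t) → HasIntegral f a b I → HasIntegral g a b I
  integral-cong fg h ε ε>0 = let (δ , δ>0 , k) = h ε ε>0 in δ , δ>0 , λ P m → ≤-trans
    (≤-reflexive (∣∣-cong (+-cong (≈-sym (riemannSum-cong fg P)) ≈-refl))) (k P m)

  integral-+ : ∀ {f g a b I J} → HasIntegral f a b I → HasIntegral g a b J →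
               HasIntegral (λ t → f t + g t) a b (I + J)
  integral-+ {f} {g} {a} {b} {I} {J} h k ε ε>0 = let
      (q , q>0 , q≤ε)    = below ε>0
      (δ , δ>0 , hδ)     = h (fromℚ (½ ℚ.* q)) (fromℚ-pos (½-pos q>0))
      (δ′ , δ′>0 , kδ′)  = k (fromℚ (½ ℚ.* q)) (fromℚ-pos (½-pos q>0))
      (r , r>0 , r≤δ)    = below δ>0
      (r′ , r′>0 , r′≤δ′) = below δ′>0
    in fromℚ (r ℚ.⊓ r′) , fromℚ-pos (⊓-pos r>0 r′>0) , λ P m →
       ≤-trans (≤-reflexive (∣∣-cong (≈-trans (+-cong (riemannSum-+ f g P) ≈-refl)
           (pointwise λ n → eq (seq (riemannSum f P) n) (seq (riemannSum g P) n) (seq I n) (seq J n)))))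
        (≤-trans (∣+∣≤ (riemannSum f P - I) (riemannSum g P - J))
        (≤-trans (+-mono-≤
          (hδ P (mesh-≤ (≤-trans (fromℚ-mono-≤ (ℚP.p⊓q≤p r r′)) r≤δ) P m))
          (kδ′ P (mesh-≤ (≤-trans (fromℚ-mono-≤ (ℚP.p⊓q≤q r r′)) r′≤δ′) P m)))
        (≤-trans (≤-reflexive (pointwise λ _ → ½+½ q)) q≤ε)))
    where
    ⊓-pos : ∀ {p q} → 0ℚ ℚ.< p → 0ℚ ℚ.< q → 0ℚ ℚ.< p ℚ.⊓ q
    ⊓-pos {p} {q} p>0 q>0 with ℚP.⊓-sel p q
    ... | inj₁ e = ≡.subst (0ℚ ℚ.<_) (≡.sym e) p>0
    ... | inj₂ e = ≡.subst (0ℚ ℚ.<_) (≡.sym e) q>0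
    eq : ∀ u v i j → (u ℚ.+ v) ℚ.- (i ℚ.+ j) ≡ (u ℚ.- i) ℚ.+ (v ℚ.- j)
    eq = solve-∀ ℚ-solverRing

  integral-* : ∀ c {f a b I} → HasIntegral f a b I → HasIntegral (λ t → c * f t) a b (c * I)
  integral-* c {f} {a} {b} {I} h ε ε>0 = let
      (q , q>0 , q≤ε) = below ε>0
      (A , A>0 , c≤A) = above c
      (r , r>0 , Ar)  = divide A q A>0 q>0
      (δ , δ>0 , hδ)  = h (fromℚ r) (fromℚ-pos r>0)
    in δ , δ>0 , λ P m → ≤-trans
         (≤-reflexive (≈-trans (∣∣-cong (≈-trans (+-cong (riemannSum-* c f P) ≈-refl)
           (pointwise λ n → eq (seq c n) (seq (riemannSum f P) n) (seq I n))))
           (∣*∣ c (riemannSum f P - I))))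
       (≤-trans (*-mono-≤ (0≤∣x∣ c) (fromℚ-mono-≤ (ℚP.<⇒≤ r>0)) c≤A (hδ P m))
       (≤-trans (≤-reflexive (pointwise λ _ → Ar)) q≤ε))
    where
    eq : ∀ c u i → c ℚ.* u ℚ.- c ℚ.* i ≡ c ℚ.* (u ℚ.- i)
    eq = solve-∀ ℚ-solverRing

  ^-nonNeg : ∀ {a} → 0ℝ ≤ a → ∀ k → 0ℝ ≤ a ^ k
  ^-nonNeg 0≤a zero    = fromℚ-mono-≤ (ℚP.<⇒≤ (ℚP.positive⁻¹ 1ℚ))
  ^-nonNeg 0≤a (suc k) = *-nonNeg 0≤a (^-nonNeg 0≤a k)

  ^-mono-≤ : ∀ {a b} → 0ℝ ≤ a → a ≤ b → ∀ k → a ^ k ≤ b ^ k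
  ^-mono-≤ 0≤a a≤b zero    = ≤-refl
  ^-mono-≤ 0≤a a≤b (suc k) = *-mono-≤ 0≤a (^-nonNeg (≤-trans 0≤a a≤b) k) a≤b (^-mono-≤ 0≤a a≤b k)

  fromℕ-const : ∀ m n → seq (fromℕ m) n ≡ seq (fromℕ m) 0
  fromℕ-const zero    n = ≡.refl
  fromℕ-const (suc m) n = ≡.cong (1ℚ ℚ.+_) (fromℕ-const m n)

  fromℕ-seq-nonNeg : ∀ m → 0ℚ ℚ.≤ seq (fromℕ m) 0
  fromℕ-seq-nonNeg zero    = ℚP.≤-refl
  fromℕ-seq-nonNeg (suc m) = ℚP.+-mono-≤ {0ℚ} {1ℚ} {0ℚ} (ℚP.<⇒≤ (ℚP.positive⁻¹ 1ℚ)) (fromℕ-seq-nonNeg m)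

  fromℕ-seq-pos : ∀ m → 0ℚ ℚ.< seq (fromℕ (suc m)) 0
  fromℕ-seq-pos m = ℚP.+-mono-<-≤ {0ℚ} {1ℚ} {0ℚ} (ℚP.positive⁻¹ 1ℚ) (fromℕ-seq-nonNeg m)

  fromℕ-nonNeg : ∀ m → 0ℝ ≤ fromℕ m
  fromℕ-nonNeg m = ≤-trans (fromℚ-mono-≤ (fromℕ-seq-nonNeg m))
    (≤-reflexive (pointwise λ n → ≡.sym (fromℕ-const m n)))

  inverse : ∀ m q → 0ℚ ℚ.< q → ∃ λ r → 0ℚ ℚ.< r × fromℕ (suc m) * fromℚ r ≈ fromℚ q
  inverse m q q>0 = let (r , r>0 , e) = divide (seq (fromℕ (suc m)) 0) q (fromℕ-seq-pos m) q>0
    in r , r>0 , pointwise λ n → ≡.trans (≡.cong (ℚ._* r) (fromℕ-const (suc m) n)) e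

  increment-upper : ∀ k {a p} → 0ℝ ≤ a → a ≤ p →
    p ^ suc k - a ^ suc k ≤ fromℕ (suc k) * p ^ k * (p - a)
  increment-upper zero {a} {p} 0≤a a≤p = ≤-reflexive (pointwise λ n → eq (seq a n) (seq p n))
    where
    eq : ∀ a p → p ℚ.* 1ℚ ℚ.- a ℚ.* 1ℚ ≡ (1ℚ ℚ.+ 0ℚ) ℚ.* 1ℚ ℚ.* (p ℚ.- a)
    eq = solve-∀ ℚ-solverRing
  increment-upper (suc k) {a} {p} 0≤a a≤p = ≤-trans
    (≤-reflexive (pointwise λ n → eq (seq a n) (seq p n) (seq (a ^ suc k) n) (seq (p ^ suc k) n)))
    (≤-trans (+-mono-≤
      (*-monoˡ-≤ (≤-trans 0≤a a≤p) (increment-upper k 0≤a a≤p))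
      (*-monoʳ-≤ (0≤y-x a≤p) (^-mono-≤ 0≤a a≤p (suc k))))
    (≤-reflexive (pointwise λ n → eq′ (seq a n) (seq p n) (seq (p ^ k) n) (seq (fromℕ (suc k)) n))))
    where
    eq : ∀ a p A P → p ℚ.* P ℚ.- a ℚ.* A ≡ p ℚ.* (P ℚ.- A) ℚ.+ A ℚ.* (p ℚ.- a)
    eq = solve-∀ ℚ-solverRing
    eq′ : ∀ a p Q s → p ℚ.* (s ℚ.* Q ℚ.* (p ℚ.- a)) ℚ.+ (p ℚ.* Q) ℚ.* (p ℚ.- a)
                      ≡ (1ℚ ℚ.+ s) ℚ.* (p ℚ.* Q) ℚ.* (p ℚ.- a)
    eq′ = solve-∀ ℚ-solverRing

  increment-lower : ∀ k {a p} → 0ℝ ≤ a → a ≤ p →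
    fromℕ (suc k) * a ^ k * (p - a) ≤ p ^ suc k - a ^ suc k
  increment-lower zero {a} {p} 0≤a a≤p = ≤-reflexive (pointwise λ n → eq (seq a n) (seq p n))
    where
    eq : ∀ a p → (1ℚ ℚ.+ 0ℚ) ℚ.* 1ℚ ℚ.* (p ℚ.- a) ≡ p ℚ.* 1ℚ ℚ.- a ℚ.* 1ℚ
    eq = solve-∀ ℚ-solverRing
  increment-lower (suc k) {a} {p} 0≤a a≤p = ≤-trans
    (≤-reflexive (pointwise λ n → eq′ (seq a n) (seq p n) (seq (a ^ k) n) (seq (fromℕ (suc k)) n)))
    (≤-trans (+-mono-≤
      (*-monoˡ-≤ 0≤a (increment-lower k 0≤a a≤p))
      (*-monoʳ-≤ (0≤y-x a≤p) (^-mono-≤ 0≤a a≤p (suc k))))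
    (≤-reflexive (pointwise λ n → eq (seq a n) (seq p n) (seq (a ^ suc k) n) (seq (p ^ suc k) n))))
    where
    eq : ∀ a p A P → a ℚ.* (P ℚ.- A) ℚ.+ P ℚ.* (p ℚ.- a) ≡ p ℚ.* P ℚ.- a ℚ.* A
    eq = solve-∀ ℚ-solverRing
    eq′ : ∀ a p Q s → (1ℚ ℚ.+ s) ℚ.* (a ℚ.* Q) ℚ.* (p ℚ.- a)
                      ≡ a ℚ.* (s ℚ.* Q ℚ.* (p ℚ.- a)) ℚ.+ (a ℚ.* Q) ℚ.* (p ℚ.- a)
    eq′ = solve-∀ ℚ-solverRing

  increment-tag : ∀ k {a ξ p δ} → 0ℝ ≤ a → a ≤ ξ → ξ ≤ p → p - a ≤ δ →
    ∣ fromℕ (suc k) * ξ ^ k * (p - a) - (p ^ suc k - a ^ suc k) ∣ ≤ fromℕ (suc k) * δ * (p ^ k - a ^ k)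
  increment-tag k {a} {ξ} {p} {δ} 0≤a a≤ξ ξ≤p p-a≤δ = ≤-trans
    (between
      (*-monoʳ-≤ 0≤p-a (*-monoˡ-≤ (fromℕ-nonNeg (suc k)) (^-mono-≤ 0≤a a≤ξ k)))
      (*-monoʳ-≤ 0≤p-a (*-monoˡ-≤ (fromℕ-nonNeg (suc k)) (^-mono-≤ (≤-trans 0≤a a≤ξ) ξ≤p k)))
      (increment-lower k 0≤a a≤p) (increment-upper k 0≤a a≤p))
    (≤-trans (≤-reflexive (pointwise λ n → eq (seq (fromℕ (suc k)) n) (seq (a ^ k) n) (seq (p ^ k) n) (seq (p - a) n)))
    (*-monoʳ-≤ (0≤y-x (^-mono-≤ 0≤a a≤p k)) (*-monoˡ-≤ (fromℕ-nonNeg (suc k)) p-a≤δ)))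
    where
    a≤p : a ≤ p
    a≤p = ≤-trans a≤ξ ξ≤p
    0≤p-a : 0ℝ ≤ p - a
    0≤p-a = 0≤y-x a≤p
    eq : ∀ s A P d → s ℚ.* P ℚ.* d ℚ.- s ℚ.* A ℚ.* d ≡ s ℚ.* d ℚ.* (P ℚ.- A)
    eq = solve-∀ ℚ-solverRing

  riemannSum-^ : ∀ k {δ a b} → 0ℝ ≤ a → (P : TaggedPartition a b) → MeshAtMost δ P →
    ∣ riemannSum (λ t → fromℕ (suc k) * t ^ k) P - (b ^ suc k - a ^ suc k) ∣
      ≤ fromℕ (suc k) * δ * (b ^ k - a ^ k)
  riemannSum-^ k {δ} {a} {b} 0≤a (done a≈b) _ = ≤-reflexive (≈-trans lhs≈0 (≈-sym rhs≈0))
    where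
    zero-diff : ∀ {x y} → x ≈ y → y - x ≈ 0ℝ
    zero-diff {x} {y} x≈y = ≈-trans (+-cong (≈-sym x≈y) ≈-refl) (ℝ-Ring.-‿inverseʳ x)
    ∣0-0∣ : ∣ 0ℝ - 0ℝ ∣ ≈ 0ℝ
    ∣0-0∣ = pointwise λ _ → ≡.refl
    lhs≈0 : ∣ 0ℝ - (b ^ suc k - a ^ suc k) ∣ ≈ 0ℝ
    lhs≈0 = ≈-trans (∣∣-cong (+-cong (≈-refl {0ℝ}) (neg-cong (zero-diff (^-congˡ (suc k) a≈b))))) ∣0-0∣
    rhs≈0 : fromℕ (suc k) * δ * (b ^ k - a ^ k) ≈ 0ℝ
    rhs≈0 = ≈-trans (*-cong (≈-refl {fromℕ (suc k) * δ}) (zero-diff (^-congˡ k a≈b)))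
      (ℝ-Ring.zeroʳ (fromℕ (suc k) * δ))
  riemannSum-^ k {δ} {a} {b} 0≤a (step ξ p a≤ξ ξ≤p P) (h , m) = ≤-trans
    (≤-reflexive (∣∣-cong (pointwise λ n → eq (seq (fromℕ (suc k) * ξ ^ k * (p - a)) n)
       (seq (riemannSum (λ t → fromℕ (suc k) * t ^ k) P) n)
       (seq (a ^ suc k) n) (seq (b ^ suc k) n) (seq (p ^ suc k) n))))
    (≤-trans (∣+∣≤ (fromℕ (suc k) * ξ ^ k * (p - a) - (p ^ suc k - a ^ suc k)) 
                   (riemannSum (λ t → fromℕ (suc k) * t ^ k) P - (b ^ suc k - p ^ suc k)))
    (≤-trans (+-mono-≤ (increment-tag k 0≤a a≤ξ ξ≤p h)
                       (riemannSum-^ k (≤-trans 0≤a (≤-trans a≤ξ ξ≤p)) P m))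
    (≤-reflexive (pointwise λ n → eq′ (seq (fromℕ (suc k) * δ) n)
       (seq (a ^ k) n) (seq (b ^ k) n) (seq (p ^ k) n)))))
    where
    eq : ∀ u R a b p → (u ℚ.+ R) ℚ.- (b ℚ.- a) ≡ (u ℚ.- (p ℚ.- a)) ℚ.+ (R ℚ.- (b ℚ.- p))
    eq = solve-∀ ℚ-solverRing
    eq′ : ∀ s a b p → s ℚ.* (p ℚ.- a) ℚ.+ s ℚ.* (b ℚ.- p) ≡ s ℚ.* (b ℚ.- a)
    eq′ = solve-∀ ℚ-solverRing

  1^k≈1 : ∀ k → 1ℝ ^ k ≈ 1ℝ
  1^k≈1 zero    = ≈-refl
  1^k≈1 (suc k) = ≈-trans (ℝ-Ring.*-identityˡ (1ℝ ^ k)) (1^k≈1 k)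

  integral-^ : ∀ k → HasIntegral (λ t → fromℕ (suc k) * t ^ k) 0ℝ 1ℝ 1ℝ
  integral-^ k ε ε>0 = let
      (q , q>0 , q≤ε) = below ε>0
      (r , r>0 , sr)  = inverse k q q>0
    in fromℚ r , fromℚ-pos r>0 , λ P m → ≤-trans
      (≤-reflexive (∣∣-cong (+-cong (≈-refl {riemannSum (λ t → fromℕ (suc k) * t ^ k) P}) (neg-cong (≈-sym diff)))))
      (≤-trans (riemannSum-^ k ≤-refl P m)
      (≤-trans (*-mono-≤ (≤-trans (fromℚ-mono-≤ (ℚP.<⇒≤ q>0)) (≤-reflexive (≈-sym sr)))
                 (fromℚ-mono-≤ (ℚP.<⇒≤ (ℚP.positive⁻¹ 1ℚ))) (≤-reflexive sr) diff≤1)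
      (≤-trans (≤-reflexive (ℝ-Ring.*-identityʳ (fromℚ q))) q≤ε)))
    where
    diff : 1ℝ ^ suc k - 0ℝ ^ suc k ≈ 1ℝ
    diff = ≈-trans (+-cong (1^k≈1 (suc k)) (neg-cong (ℝ-Ring.zeroˡ (0ℝ ^ k)))) (pointwise λ _ → ≡.refl)
    diff≤1 : 1ℝ ^ k - 0ℝ ^ k ≤ 1ℝ
    diff≤1 = ≤-trans (+-mono-≤ (≤-reflexive (1^k≈1 k)) (neg-anti-≤ (^-nonNeg ≤-refl k)))
      (≤-reflexive (pointwise λ _ → ≡.refl))

  integrable-^ : ∀ k → Integrable (_^ k) 0ℝ 1ℝ
  integrable-^ k = let (r , _ , sr) = inverse k 1ℚ (ℚP.positive⁻¹ 1ℚ) in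
    fromℚ r * 1ℝ , integral-cong
    (λ t → ≈-trans (≈-sym (ℝ-Ring.*-assoc (fromℚ r) (fromℕ (suc k)) (t ^ k)))
      (≈-trans (*-cong (≈-trans (ℝ-Ring.*-comm (fromℚ r) (fromℕ (suc k))) sr) ≈-refl)
        (ℝ-Ring.*-identityˡ (t ^ k))))
    (integral-* (fromℚ r) (integral-^ k))

fallingFactorial : ℝ → ℕ → ℝ
fallingFactorial z zero    = 1ℝ
fallingFactorial z (suc n) = fallingFactorial z n * (z - fromℕ n)

1/_! : ℕ → ℝ
1/ n ! = fromℚ ((ℤ.+ 1 ℚ./ n !) {{n ℕP.!≢0}})

binom : ℝ → ℕ → ℝ
binom z n = fallingFactorial z n * 1/ n !

opaque
  integrable-falling : ∀ (s : ℝ → ℝ) α β → (∀ t → s t ≈ α * t + β) →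
    ∀ n k → Integrable (λ t → t ^ k * fallingFactorial (s t) n) 0ℝ 1ℝ
  integrable-falling s α β hs zero k = let (I , h) = integrable-^ k in I , integral-cong (λ t → ≈-sym (ℝ-Ring.*-identityʳ (t ^ k))) h
  integrable-falling s α β hs (suc n) k = let
      (I , h)  = integrable-falling s α β hs n (suc k)
      (J , h′) = integrable-falling s α β hs n k
    in α * I + (β - fromℕ n) * J , integral-cong
    (λ t → ≈-trans
      (pointwise λ m → eq (seq α m) (seq β m) (seq t m) (seq (t ^ k) m) (seq (fallingFactorial (s t) n) m) (seq (fromℕ n) m))
      (*-cong (≈-refl {t ^ k}) (*-cong (≈-refl {fallingFactorial (s t) n}) (+-cong (≈-sym (hs t)) ≈-refl))))
    (integral-+ (integral-* α h) (integral-* (β - fromℕ n) h′))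
    where
    eq : ∀ α β t T F N → α ℚ.* ((t ℚ.* T) ℚ.* F) ℚ.+ (β ℚ.- N) ℚ.* (T ℚ.* F)
                         ≡ T ℚ.* (F ℚ.* ((α ℚ.* t ℚ.+ β) ℚ.- N))
    eq = solve-∀ ℚ-solverRing

  integrable-binom : ∀ (s : ℝ → ℝ) α β → (∀ t → s t ≈ α * t + β) →
    ∀ n → Integrable (λ t → binom (s t) n) 0ℝ 1ℝ
  integrable-binom s α β hs n = let (I , h) = integrable-falling s α β hs n 0 in
    1/ n ! * I , integral-cong
    (λ t → pointwise λ m → eq (seq (1/ n !) m) (seq (fallingFactorial (s t) n) m))
    (integral-* (1/ n !) h)
    where
    eq : ∀ r F → r ℚ.* (1ℚ ℚ.* F) ≡ F ℚ.* r
    eq = solve-∀ ℚ-solverRing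

  integrable₁ : ∀ n x → Integrable (λ t → binom (t - x) n) 0ℝ 1ℝ
  integrable₁ n x = integrable-binom (λ t → t - x) 1ℝ (- x)
    (λ t → +-cong (≈-sym (ℝ-Ring.*-identityˡ t)) ≈-refl) n

  integrable₂ : ∀ n x → Integrable (λ t → binom (x - t) n) 0ℝ 1ℝ
  integrable₂ n x = integrable-binom (λ t → x - t) (- 1ℝ) x
    (λ t → pointwise λ m → eq (seq x m) (seq t m)) n
    where
    eq : ∀ x t → x ℚ.- t ≡ (ℚ.- 1ℚ) ℚ.* t ℚ.+ x
    eq = solve-∀ ℚ-solverRing

c ĉ : ℕ → ℝ → ℝ
c n x = fromℕ (n !) * ∫ (λ t → binom (t - x) n) 0ℝ 1ℝ (integrable₁ n x)
ĉ n x = fromℕ (n !) * ∫ (λ t → binom (x - t) n) 0ℝ 1ℝ (integrable₂ n x)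

-- The statement (f y - f x) / (y - x) → d as y → x, multiplied out by y - x.
HasDerivativeAt : (ℝ → ℝ) → ℝ → ℝ → Set
HasDerivativeAt f d x = ∀ ε → 0ℝ < ε → ∃ λ δ → 0ℝ < δ ×
  (∀ y → ∣ y - x ∣ ≤ δ → ∣ f y - f x - d * (y - x) ∣ ≤ ε * ∣ y - x ∣)

IsIteratedDerivative : ℕ → (ℝ → ℝ) → (ℝ → ℝ) → Set
IsIteratedDerivative zero    f g = ∀ x → f x ≈ g x
IsIteratedDerivative (suc i) f g = ∃ λ h → IsIteratedDerivative i f h × (∀ x → HasDerivativeAt h (g x) x)

-- Σ_{m=a}^{b} f m, which has suc b ∸ a terms and so is empty when b < a.
∑ : ℕ → ℕ → (ℕ → ℝ) → ℝ
∑ a b f = sum {suc b ∸ a} (λ k → f (a ℕ.+ toℕ k))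

stirling₁ : ℕ → ℕ → ℕ
stirling₁ zero    zero    = 1
stirling₁ zero    (suc m) = 0
stirling₁ (suc n) zero    = 0
stirling₁ (suc n) (suc m) = n ℕ.* stirling₁ n (suc m) ℕ.+ stirling₁ n m

-- Meant for m ≤ n only, where n ∸ m is the true difference.
genStirling₁ : ℕ → ℕ → ℝ → ℝ
genStirling₁ n m x =
  ∑ 0 (n ∸ m) (λ i → fromℕ ((i ℕ.+ m) C m) * fromℕ (stirling₁ n (i ℕ.+ m)) * x ^ i)

{-# OPTIONS --safe #-}
-- Everything reduces to the case i = 0. There, integrals are linear and unique,
-- so integrating Vandermonde's convolution
--   (t − x)_n = Σ_m C(n,m) (t)_{n−m} (−x)_m,  (−x)_m = (−1)^m [m,0]_x
-- for falling factorials expresses c_n(x) through the numbers c_{n−m}; for ĉ_n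
-- one convolves (−t)_{n−m} with (x)_m instead. Higher i then follow term by term
-- from d/dx [m,i]_x = (i+1) [m,i+1]_x, which is the binomial identity
-- (i+1) C(j+1+i,i+1) = (j+1) C(j+1+i,i) on coefficients.
module Submission where

open import Defs
open import Algebra.Properties.Monoid.Mult ℝ-Ring.+-monoid using (×-homo-+)
open import Algebra.Properties.Semiring.Mult ℝ-Ring.semiring using (×1-homo-*)
open import Algebra.Properties.Semiring.Sum ℝ-Ring.semiring
  using (sum-cong-≋; ∑-distrib-+; *-distribˡ-sum)
open import Data.Fin.Base using (Fin; zero; suc; toℕ)
import Data.Integer.Base as ℤ
import Data.Integer.Properties as ℤP
import Data.Integer.Tactic.RingSolver as ℤSolver
open import Data.Nat.Base as ℕ using (ℕ; zero; suc; _∸_; _!; s≤s; z≤n)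
open import Data.Nat.Combinatorics
  using (_C_; nC1≡n; nCk≡nC[n∸k]; nCk+nC[k+1]≡[n+1]C[k+1]; k>n⇒nCk≡0)
import Data.Nat.Properties as ℕP
import Data.Nat.Tactic.RingSolver as ℕSolver
open import Data.Product.Base using (Σ; ∃; _×_; _,_; proj₂)
open import Data.Rational.Base as ℚ using (ℚ; 0ℚ; 1ℚ; ½)
import Data.Rational.Properties as ℚP
open import Data.Rational.Unnormalised.Base as ℚᵘ using (mkℚᵘ; *≡*; *≤*)
import Data.Rational.Unnormalised.Properties as ℚᵘP
open import Data.Sum.Base using (inj₁; inj₂)
open import Relation.Binary.PropositionalEquality.Core as ≡ using (_≡_)
open import Relation.Binary.Reasoning.Setoid ℝ-Ring.setoid
open import Relation.Nullary.Decidable.Core using (yes; no)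
open import Tactic.RingSolver using (solve-∀)

-- Uniqueness of the Riemann integral over [0, 1]

toℚᵘ-fromℕ : ∀ n k → ℚ.toℚᵘ (seq (fromℕ n) k) ℚᵘ.≃ mkℚᵘ (ℤ.+ n) 0
toℚᵘ-fromℕ zero    k = ℚᵘP.≃-refl
toℚᵘ-fromℕ (suc n) k =
  ℚᵘP.≃-trans (ℚP.toℚᵘ-homo-+ 1ℚ (seq (fromℕ n) k))
  (ℚᵘP.≃-trans (ℚᵘP.+-congʳ ℚᵘ.1ℚᵘ (toℚᵘ-fromℕ n k))
  (*≡* (eq (ℤ.+ n))))
  where
  eq : ∀ z → (ℤ.+ 1 ℤ.* ℤ.+ 1 ℤ.+ z ℤ.* ℤ.+ 1) ℤ.* ℤ.+ 1 ≡ (ℤ.+ 1 ℤ.+ z) ℤ.* (ℤ.+ 1)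
  eq = ℤSolver.solve-∀

-- Checked among unnormalised rationals, where no gcd has to be computed and equality is
-- cross-multiplication of integers.
fromℕ*1/n≈1 : ∀ n .{{_ : ℕ.NonZero n}} → fromℕ n * fromℚ (ℤ.+ 1 ℚ./ n) ≈ 1ℝ
fromℕ*1/n≈1 n@(suc m) = pointwise λ k → ℚP.toℚᵘ-injective
  (ℚᵘP.≃-trans (ℚP.toℚᵘ-homo-* (seq (fromℕ n) k) (ℤ.+ 1 ℚ./ n))
  (ℚᵘP.≃-trans (ℚᵘP.*-cong (toℚᵘ-fromℕ n k) (ℚP.toℚᵘ-fromℚᵘ (mkℚᵘ (ℤ.+ 1) m)))
  (*≡* (eq (ℤ.+ n)))))
  where
  eq : ∀ z → (z ℤ.* ℤ.+ 1) ℤ.* ℤ.+ 1 ≡ ℤ.+ 1 ℤ.* (ℤ.+ 1 ℤ.* z)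
  eq = ℤSolver.solve-∀

archimedean : ∀ q → 0ℚ ℚ.< q → ∃ λ m → ℤ.+ 1 ℚ./ suc m ℚ.≤ q
-- The stored denominator is `suc d` and the numerator is at least 1, so q is at least 1 / `suc d`.
archimedean q@(ℚ.mkℚ (ℤ.+ suc k) d _) _ = d , ℚP.toℚᵘ-cancel-≤
  (ℚᵘP.≤-respˡ-≃ (ℚᵘP.≃-sym (ℚP.toℚᵘ-fromℚᵘ (mkℚᵘ (ℤ.+ 1) d)))
    (*≤* (ℤP.*-monoʳ-≤-nonNeg (ℤ.+ suc d) {ℤ.+ 1} {ℤ.+ suc k} (ℤ.+≤+ (ℕ.s≤s ℕ.z≤n)))))
archimedean (ℚ.mkℚ (ℤ.+ zero) _ _) q>0 with ℚ.positive q>0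
... | ()
archimedean (ℚ.mkℚ ℤ.-[1+ _ ] _ _) q>0 with ℚ.positive q>0
... | ()

-- The right end is tied to `a + fromℕ N * h` only by `_≈_`, so the recursive call from `a + h`
-- keeps the index `b`.
uniformPartition : ∀ N {h} → 0ℝ ≤ h → ∀ {a b} → a + fromℕ N * h ≈ b →
  Σ (TaggedPartition a b) (MeshAtMost h)
uniformPartition zero {h} 0≤h {a} e =
  done (≈-trans (pointwise λ k → eq (seq a k) (seq h k)) e) , _
  where
  eq : ∀ a h → a ≡ a ℚ.+ 0ℚ ℚ.* h
  eq = solve-∀ ℚ-solverRing
uniformPartition (suc N) {h} 0≤h {a} e =
  let P , fine = uniformPartition N 0≤h {a + h}
        (≈-trans (pointwise λ k → eq (seq a k) (seq h k) (seq (fromℕ N) k)) e)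
  in step a (a + h) ≤-refl (0≤y-x⁻¹ (≤-trans 0≤h (≤-reflexive (≈-sym a+h-a)))) P
   , ≤-reflexive a+h-a , fine
  where
  eq : ∀ a h n → (a ℚ.+ h) ℚ.+ n ℚ.* h ≡ a ℚ.+ (1ℚ ℚ.+ n) ℚ.* h
  eq = solve-∀ ℚ-solverRing
  eq′ : ∀ a h → (a ℚ.+ h) ℚ.- a ≡ h
  eq′ = solve-∀ ℚ-solverRing
  a+h-a : (a + h) - a ≈ h
  a+h-a = pointwise λ k → eq′ (seq a k) (seq h k)

finePartition : ∀ {δ} → 0ℝ < δ → Σ (TaggedPartition 0ℝ 1ℝ) (MeshAtMost δ)
finePartition δ>0 =
  let q , q>0 , q≤δ = below δ>0
      m , 1/m≤q     = archimedean q q>0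
      P , fine      = uniformPartition (suc m)
                        (fromℚ-mono-≤ (ℚP.nonNegative⁻¹ (ℤ.+ 1 ℚ./ suc m) {{ℚP.normalize-nonNeg 1 (suc m)}}))
                        (≈-trans (+-identityˡ _) (fromℕ*1/n≈1 (suc m)))
  in P , mesh-≤ (≤-trans (fromℚ-mono-≤ 1/m≤q) q≤δ) P fine

½ε<ε : ∀ {ε} → 0ℚ ℚ.< ε → ½ ℚ.* ε ℚ.< ε
½ε<ε {ε} ε>0 = ≡.subst₂ ℚ._<_ (ℚP.+-identityʳ (½ ℚ.* ε)) (½+½ ε) (ℚP.+-monoʳ-< (½ ℚ.* ε) (½-pos ε>0))

arbitrarilyClose⇒≈ : ∀ {x y} → (∀ q → 0ℚ ℚ.< q → ∣ x - y ∣ ≤ fromℚ q) → x ≈ y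
arbitrarilyClose⇒≈ {x} {y} h = mk≈ λ ε ε>0 →
  -- The hypothesis bounds the distance by q, and `_≤_` between reals allows a further slack q;
  -- together they make half of ε, which is strictly below ε.
  let q   = ½ ℚ.* (½ ℚ.* ε)
      q>0 = ½-pos (½-pos ε>0)
  in ev-map (λ k le → ℚP.≤-<-trans (ℚP.≤-trans le (ℚP.≤-reflexive (½+½ (½ ℚ.* ε)))) (½ε<ε ε>0))
       (almost (h q q>0) q q>0)

⊓-pos : ∀ {p q} → 0ℚ ℚ.< p → 0ℚ ℚ.< q → 0ℚ ℚ.< p ℚ.⊓ q
⊓-pos {p} {q} p>0 q>0 with ℚP.⊓-sel p q
... | inj₁ e = ≡.subst (0ℚ ℚ.<_) (≡.sym e) p>0
... | inj₂ e = ≡.subst (0ℚ ℚ.<_) (≡.sym e) q>0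

-- Both values are within q/2 of the Riemann sum of one partition that is fine enough for both.
integral-unique : ∀ {f I J} → HasIntegral f 0ℝ 1ℝ I → HasIntegral f 0ℝ 1ℝ J → I ≈ J
integral-unique {f} {I} {J} h k = arbitrarilyClose⇒≈ λ q q>0 →
  let ε   = fromℚ (½ ℚ.* q)
      ε>0 = fromℚ-pos (½-pos q>0)
      δ , δ>0 , hδ    = h ε ε>0
      δ′ , δ′>0 , kδ′ = k ε ε>0
      r , r>0 , r≤δ    = below δ>0
      r′ , r′>0 , r′≤δ′ = below δ′>0
      P , fine = finePartition (fromℚ-pos (⊓-pos r>0 r′>0))
      S = riemannSum f P
  in ≤-trans (≤-reflexive (∣∣-cong (pointwise λ m → eq (seq I m) (seq J m) (seq S m))))
    (≤-trans (∣+∣≤ (- (S - I)) (S - J))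
    (≤-trans (+-mono-≤
      (≤-trans (≤-reflexive (pointwise λ m → ℚP.∣-p∣≡∣p∣ (seq (S - I) m)))
        (hδ P (mesh-≤ (≤-trans (fromℚ-mono-≤ (ℚP.p⊓q≤p r r′)) r≤δ) P fine)))
      (kδ′ P (mesh-≤ (≤-trans (fromℚ-mono-≤ (ℚP.p⊓q≤q r r′)) r′≤δ′) P fine)))
    (≤-reflexive (pointwise λ _ → ½+½ q))))
  where
  eq : ∀ i j s → i ℚ.- j ≡ (ℚ.- (s ℚ.- i)) ℚ.+ (s ℚ.- j)
  eq = solve-∀ ℚ-solverRing

-- Derivatives through quadratic remainders

-- Unlike differentiability with ε and δ, a quadratic bound is preserved by sums
-- and products through explicit constants, which suffices for polynomials.
QuadraticRemainder : (ℝ → ℝ) → ℝ → ℝ → Set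
QuadraticRemainder f d x = ∃ λ K → ∀ y → ∣ y - x ∣ ≤ 1ℝ →
  ∣ f y - f x - d * (y - x) ∣ ≤ K * (∣ y - x ∣ * ∣ y - x ∣)

x≤∣x∣ : ∀ x → x ≤ ∣ x ∣
x≤∣x∣ x = pointwise-≤ λ k → p≤∣p∣ (seq x k)

quadraticRemainder⇒derivative : ∀ {f d x} → QuadraticRemainder f d x → HasDerivativeAt f d x
quadraticRemainder⇒derivative {f} {d} {x} (K , bound) ε ε>0 =
  let q , q>0 , q≤ε = below ε>0
      A , A>0 , K≤A = above K
      r , r>0 , Ar  = divide A q A>0 q>0
  -- For s = |y - x| ≤ r one has K s² ≤ A r s = q s ≤ ε s. The minimum with 1 keeps y in the range
  -- where `bound` applies.
  in fromℚ (r ℚ.⊓ 1ℚ) , fromℚ-pos (⊓-pos r>0 (ℚP.positive⁻¹ 1ℚ)) , λ y y~x →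
    let s = ∣ y - x ∣ in
    ≤-trans (bound y (≤-trans y~x (fromℚ-mono-≤ (ℚP.p⊓q≤q r 1ℚ))))
    (≤-trans (*-monoʳ-≤ (*-nonNeg (0≤∣x∣ (y - x)) (0≤∣x∣ (y - x))) (≤-trans (x≤∣x∣ K) K≤A))
    (≤-trans (≤-reflexive (≈-sym (*-assoc (fromℚ A) s s)))
    (*-monoʳ-≤ (0≤∣x∣ (y - x))
      (≤-trans (*-monoˡ-≤ (fromℚ-mono-≤ (ℚP.<⇒≤ A>0)) (≤-trans y~x (fromℚ-mono-≤ (ℚP.p⊓q≤p r 1ℚ))))
      (≤-trans (≤-reflexive (pointwise λ _ → Ar)) q≤ε)))))

remainder-const : ∀ c x → QuadraticRemainder (λ _ → c) 0ℝ x
remainder-const c x = 0ℝ , λ y _ → ≤-reflexive (pointwise λ k →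
  ≡.trans (≡.cong ℚ.∣_∣ (eq (seq c k) (seq (y - x) k)))
    (≡.sym (ℚP.*-zeroˡ (seq (∣ y - x ∣ * ∣ y - x ∣) k))))
  where
  eq : ∀ c z → c ℚ.- c ℚ.- 0ℚ ℚ.* z ≡ 0ℚ
  eq = solve-∀ ℚ-solverRing

remainder-cong : ∀ {f g d e x} → (∀ y → f y ≈ g y) → d ≈ e →
  QuadraticRemainder f d x → QuadraticRemainder g e x
remainder-cong {x = x} f≈g d≈e (K , bound) = K , λ y y~x → ≤-trans
  (≤-reflexive (∣∣-cong (≈-sym
    (+-cong (+-cong (f≈g y) (neg-cong (f≈g x))) (neg-cong (*-cong d≈e ≈-refl))))))
  (bound y y~x)

remainder-+ : ∀ {f g d e x} → QuadraticRemainder f d x → QuadraticRemainder g e x →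
  QuadraticRemainder (λ y → f y + g y) (d + e) x
remainder-+ {f} {g} {d} {e} {x} (K , p) (L , q) = K + L , λ y y~x → ≤-trans
  (≤-reflexive (∣∣-cong (pointwise λ k →
    eq (seq (f y) k) (seq (f x) k) (seq (g y) k) (seq (g x) k) (seq d k) (seq e k) (seq (y - x) k))))
  (≤-trans (∣+∣≤ (f y - f x - d * (y - x)) (g y - g x - e * (y - x)))
  (≤-trans (+-mono-≤ (p y y~x) (q y y~x))
  (≤-reflexive (≈-sym (*-distribʳ-+ (∣ y - x ∣ * ∣ y - x ∣) K L)))))
  where
  eq : ∀ a b c h d e z → (a ℚ.+ c) ℚ.- (b ℚ.+ h) ℚ.- (d ℚ.+ e) ℚ.* z
                         ≡ (a ℚ.- b ℚ.- d ℚ.* z) ℚ.+ (c ℚ.- h ℚ.- e ℚ.* z)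
  eq = solve-∀ ℚ-solverRing

remainder-* : ∀ c {f d x} → QuadraticRemainder f d x → QuadraticRemainder (λ y → c * f y) (c * d) x
remainder-* c {f} {d} {x} (K , p) = ∣ c ∣ * K , λ y y~x → ≤-trans
  (≤-reflexive (≈-trans
    (∣∣-cong (pointwise λ k → eq (seq c k) (seq (f y) k) (seq (f x) k) (seq d k) (seq (y - x) k)))
    (∣*∣ c (f y - f x - d * (y - x)))))
  (≤-trans (*-monoˡ-≤ (0≤∣x∣ c) (p y y~x))
  (≤-reflexive (≈-sym (*-assoc ∣ c ∣ K (∣ y - x ∣ * ∣ y - x ∣)))))
  where
  eq : ∀ c a b d z → c ℚ.* a ℚ.- c ℚ.* b ℚ.- (c ℚ.* d) ℚ.* z ≡ c ℚ.* (a ℚ.- b ℚ.- d ℚ.* z)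
  eq = solve-∀ ℚ-solverRing

-- The product rule for the factor y, from which powers are built. The remainder of y f(y) is y R +
-- d (y - x)², where R is that of f, and |y - x| ≤ 1 bounds |y| by |x| + 1.
remainder-id* : ∀ {f d x} → QuadraticRemainder f d x → QuadraticRemainder (λ y → y * f y) (x * d + f x) x
remainder-id* {f} {d} {x} (K , p) = (∣ x ∣ + 1ℝ) * K + ∣ d ∣ , λ y y~x →
  let s = ∣ y - x ∣
      R = f y - f x - d * (y - x)
      ∣y∣≤ : ∣ y ∣ ≤ ∣ x ∣ + 1ℝ
      ∣y∣≤ = ≤-trans (≤-reflexive (∣∣-cong (pointwise λ k → eq₁ (seq x k) (seq y k))))
               (≤-trans (∣+∣≤ x (y - x)) (+-mono-≤ ≤-refl y~x))
  in ≤-trans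
    (≤-reflexive (∣∣-cong (pointwise λ k →
      eq₂ (seq x k) (seq y k) (seq (f x) k) (seq (f y) k) (seq d k))))
    (≤-trans (∣+∣≤ (y * R) (d * ((y - x) * (y - x))))
    (≤-trans (+-mono-≤
      (≤-trans (≤-reflexive (∣*∣ y R))
        -- The sign of K is not known, but K s² is nonnegative because it lies above |R|.
        (*-mono-≤ (0≤∣x∣ y) (≤-trans (0≤∣x∣ R) (p y y~x)) ∣y∣≤ (p y y~x)))
      (≤-reflexive (≈-trans (∣*∣ d ((y - x) * (y - x))) (*-cong (≈-refl {∣ d ∣}) (∣*∣ (y - x) (y - x))))))
    (≤-reflexive (pointwise λ k → eq₃ (seq (∣ x ∣ + 1ℝ) k) (seq K k) (seq ∣ d ∣ k) (seq s k)))))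
  where
  eq₁ : ∀ x y → y ≡ x ℚ.+ (y ℚ.- x)
  eq₁ = solve-∀ ℚ-solverRing
  eq₂ : ∀ x y a b d → y ℚ.* b ℚ.- x ℚ.* a ℚ.- (x ℚ.* d ℚ.+ a) ℚ.* (y ℚ.- x)
        ≡ y ℚ.* (b ℚ.- a ℚ.- d ℚ.* (y ℚ.- x)) ℚ.+ d ℚ.* ((y ℚ.- x) ℚ.* (y ℚ.- x))
  eq₂ = solve-∀ ℚ-solverRing
  eq₃ : ∀ A K d s → A ℚ.* (K ℚ.* (s ℚ.* s)) ℚ.+ d ℚ.* (s ℚ.* s) ≡ (A ℚ.* K ℚ.+ d) ℚ.* (s ℚ.* s)
  eq₃ = solve-∀ ℚ-solverRing

remainder-^ : ∀ j x → QuadraticRemainder (_^ suc j) (fromℕ (suc j) * x ^ j) x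
remainder-^ zero x = remainder-cong {λ y → y * 1ℝ} (λ _ → ≈-refl) (pointwise λ k → eq (seq x k))
  (remainder-id* {λ _ → 1ℝ} (remainder-const 1ℝ x))
  where
  eq : ∀ x → x ℚ.* 0ℚ ℚ.+ 1ℚ ≡ (1ℚ ℚ.+ 0ℚ) ℚ.* 1ℚ
  eq = solve-∀ ℚ-solverRing
remainder-^ (suc j) x = remainder-cong {λ y → y * (y ^ suc j)} (λ _ → ≈-refl)
  (pointwise λ k → eq (seq x k) (seq (fromℕ (suc j)) k) (seq (x ^ j) k))
  (remainder-id* {_^ suc j} (remainder-^ j x))
  where
  eq : ∀ x n P → x ℚ.* (n ℚ.* P) ℚ.+ x ℚ.* P ≡ (1ℚ ℚ.+ n) ℚ.* (x ℚ.* P)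
  eq = solve-∀ ℚ-solverRing

remainder-sum : ∀ {n} (f : Fin n → ℝ → ℝ) (d : Fin n → ℝ) {x} →
  (∀ i → QuadraticRemainder (f i) (d i) x) → QuadraticRemainder (λ y → sum (λ i → f i y)) (sum d) x
remainder-sum {zero}  f d {x} h = remainder-const 0ℝ x
remainder-sum {suc n} f d h = remainder-+ {f zero} {λ y → sum (λ i → f (suc i) y)}
  (h zero) (remainder-sum (λ i → f (suc i)) (λ i → d (suc i)) (λ i → h (suc i)))

remainder-∘neg : ∀ {f d x} → QuadraticRemainder f d (- x) → QuadraticRemainder (λ y → f (- y)) (- d) x
remainder-∘neg {f} {d} {x} (K , p) = K , λ y y~x →
  let ∣-y--x∣ : ∣ - y - - x ∣ ≈ ∣ y - x ∣
      ∣-y--x∣ = pointwise λ k →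
        ≡.trans (≡.cong ℚ.∣_∣ (eq₁ (seq x k) (seq y k))) (ℚP.∣-p∣≡∣p∣ (seq (y - x) k))
  in ≤-trans
    (≤-reflexive (∣∣-cong (pointwise λ k →
      eq₂ (seq (f (- x)) k) (seq (f (- y)) k) (seq d k) (seq x k) (seq y k))))
    (≤-trans (p (- y) (≤-trans (≤-reflexive ∣-y--x∣) y~x))
    (≤-reflexive (*-cong (≈-refl {K}) (*-cong ∣-y--x∣ ∣-y--x∣))))
  where
  eq₁ : ∀ x y → (ℚ.- y) ℚ.- (ℚ.- x) ≡ ℚ.- (y ℚ.- x)
  eq₁ = solve-∀ ℚ-solverRing
  eq₂ : ∀ a b d x y → b ℚ.- a ℚ.- (ℚ.- d) ℚ.* (y ℚ.- x) ≡ b ℚ.- a ℚ.- d ℚ.* ((ℚ.- y) ℚ.- (ℚ.- x))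
  eq₂ = solve-∀ ℚ-solverRing

-- Binomial identities and boundary terms of sums

C-absorption : ∀ n k → suc k ℕ.* (suc n C suc k) ≡ suc n ℕ.* (n C k)
C-absorption zero zero = ≡.refl
C-absorption zero (suc k) = ≡.trans
  (≡.cong (suc (suc k) ℕ.*_) (k>n⇒nCk≡0 {1} {suc (suc k)} (s≤s (s≤s z≤n))))
  (≡.trans (ℕP.*-zeroʳ (suc (suc k))) (≡.cong (1 ℕ.*_) (≡.sym (k>n⇒nCk≡0 {0} {suc k} (s≤s z≤n)))))
C-absorption (suc n) zero = ≡.trans (ℕP.*-identityˡ _)
  (≡.trans (nC1≡n (suc (suc n))) (≡.sym (ℕP.*-identityʳ (suc (suc n)))))
C-absorption (suc n) (suc k) = let a = suc n C suc k in
  -- After Pascal's rule one copy of `a` is set aside; what remains matches the induction hypotheses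
  -- at k and k + 1.
  ≡.trans (≡.cong (suc (suc k) ℕ.*_) (≡.sym (nCk+nC[k+1]≡[n+1]C[k+1] (suc n) (suc k))))
  (≡.trans (eq (suc k) a (suc n C suc (suc k)))
  (≡.trans (≡.cong₂ (λ u v → a ℕ.+ u ℕ.+ v) (C-absorption n k) (C-absorption n (suc k)))
  (≡.trans (eq′ (suc n) a (n C k) (n C suc k))
  (≡.cong (λ u → a ℕ.+ suc n ℕ.* u) (nCk+nC[k+1]≡[n+1]C[k+1] n k)))))
  where
  eq : ∀ k a b → suc k ℕ.* (a ℕ.+ b) ≡ a ℕ.+ k ℕ.* a ℕ.+ suc k ℕ.* b
  eq = ℕSolver.solve-∀
  eq′ : ∀ n a u v → a ℕ.+ n ℕ.* u ℕ.+ n ℕ.* v ≡ a ℕ.+ n ℕ.* (u ℕ.+ v)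
  eq′ = ℕSolver.solve-∀

C-symmetric : ∀ j i → (j ℕ.+ i) C j ≡ (j ℕ.+ i) C i
C-symmetric j i = ≡.trans (nCk≡nC[n∸k] (ℕP.m≤m+n j i)) (≡.cong ((j ℕ.+ i) C_) (ℕP.m+n∸m≡n j i))

-- Both sides equal (j + i + 1) C(j + i, i): absorption applies on the left to i and on the right,
-- after symmetry, to j.
C-shift : ∀ j i → suc i ℕ.* ((suc j ℕ.+ i) C suc i) ≡ suc j ℕ.* ((suc j ℕ.+ i) C i)
C-shift j i = ≡.trans (C-absorption (j ℕ.+ i) i)
  (≡.trans (≡.cong (suc (j ℕ.+ i) ℕ.*_) (≡.sym (C-symmetric j i)))
  (≡.trans (≡.sym (C-absorption (j ℕ.+ i) j))
  (≡.cong (suc j ℕ.*_) (C-symmetric (suc j) i))))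

stirling₁-zero : ∀ {m k} → m ℕ.< k → stirling₁ m k ≡ 0
stirling₁-zero {zero}  {suc k} _         = ≡.refl
stirling₁-zero {suc m} {suc k} (s≤s m<k) = ≡.trans
  (≡.cong₂ (λ a b → m ℕ.* a ℕ.+ b) (stirling₁-zero (ℕP.m<n⇒m<1+n m<k)) (stirling₁-zero m<k))
  (≡.trans (ℕP.+-identityʳ (m ℕ.* 0)) (ℕP.*-zeroʳ m))

fromℕ-cong : ∀ {m n} → m ≡ n → fromℕ m ≈ fromℕ n
fromℕ-cong e = ℝ-Ring.reflexive (≡.cong fromℕ e)

sum-zero : ∀ {n} {f : Fin n → ℝ} → (∀ i → f i ≈ 0ℝ) → sum f ≈ 0ℝ
sum-zero {zero}  h = ≈-refl
sum-zero {suc n} h = ≈-trans (+-cong (h zero) (sum-zero (λ i → h (suc i)))) (+-identityˡ 0ℝ)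

∑-drop : ∀ a b f → f a ≈ 0ℝ → ∑ a b f ≈ ∑ (suc a) b f
∑-drop zero          b       f h = ≈-trans (+-cong h ≈-refl) (+-identityˡ (∑ 1 b f))
-- Both sums are empty here, but `zero ∸ a` computes only once the shape of `a` is known; hence two
-- clauses.
∑-drop (suc zero)    zero    f h = ≈-refl
∑-drop (suc (suc a)) zero    f h = ≈-refl
∑-drop (suc a)       (suc b) f h = ∑-drop a b (λ m → f (suc m)) h

-- Differentiating [m,i]_x leaves m ∸ i terms, whereas [m,i+1]_x sums up to m ∸ (i+1) inclusive and
-- so has one term even when m ≤ i. The hypothesis makes that extra term zero.
sum-∸ : ∀ m i (f : ℕ → ℝ) → (m ℕ.≤ i → f 0 ≈ 0ℝ) →
  sum {m ∸ i} (λ k → f (toℕ k)) ≈ ∑ 0 (m ∸ suc i) f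
sum-∸ zero    zero    f h = ≈-sym (≈-trans (+-cong (h z≤n) ≈-refl) (+-identityˡ 0ℝ))
sum-∸ zero    (suc i) f h = ≈-sym (≈-trans (+-cong (h z≤n) ≈-refl) (+-identityˡ 0ℝ))
sum-∸ (suc m) zero    f h = ≈-refl
sum-∸ (suc m) (suc i) f h = sum-∸ m i f (λ m≤i → h (s≤s m≤i))

-- Derivatives of generalized Stirling numbers and their sums

genStirling₁-coeff : ℕ → ℕ → ℕ → ℝ
genStirling₁-coeff m i j = fromℕ ((j ℕ.+ i) C i) * fromℕ (stirling₁ m (j ℕ.+ i))

genStirling₁-coeff₀ : ∀ {m i} x → m ℕ.< i → genStirling₁-coeff m i 0 * x ^ 0 ≈ 0ℝ
genStirling₁-coeff₀ {m} {i} x m<i = ≈-trans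
  (*-cong (*-cong (≈-refl {fromℕ (i C i)}) (fromℕ-cong (stirling₁-zero m<i))) ≈-refl)
  (pointwise λ k → eq (seq (fromℕ (i C i)) k))
  where
  eq : ∀ a → a ℚ.* 0ℚ ℚ.* 1ℚ ≡ 0ℚ
  eq = solve-∀ ℚ-solverRing

-- Truncated subtraction leaves the single term of exponent 0, whose factor `stirling₁ m i`
-- vanishes.
genStirling₁-zero : ∀ {m i} x → m ℕ.< i → genStirling₁ m i x ≈ 0ℝ
genStirling₁-zero {m} {i} x m<i rewrite ℕP.m≤n⇒m∸n≡0 (ℕP.<⇒≤ m<i) =
  ≈-trans (+-identityʳ _) (genStirling₁-coeff₀ x m<i)

genStirling₁-remainder : ∀ m i x →
  QuadraticRemainder (genStirling₁ m i) (fromℕ (suc i) * genStirling₁ m (suc i) x) x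
genStirling₁-remainder m i x = remainder-cong {genStirling₁ m i} (λ _ → ≈-refl) (begin
    0ℝ + sum {m ∸ i} (λ k → coeff i (suc (toℕ k)) * (fromℕ (suc (toℕ k)) * x ^ toℕ k))
      ≈⟨ +-identityˡ _ ⟩
    sum {m ∸ i} (λ k → coeff i (suc (toℕ k)) * (fromℕ (suc (toℕ k)) * x ^ toℕ k))
      ≈⟨ sum-cong-≋ {m ∸ i} (λ k → term (toℕ k)) ⟩
    sum {m ∸ i} (λ k → fromℕ (suc i) * (coeff (suc i) (toℕ k) * x ^ toℕ k))
      ≈⟨ *-distribˡ-sum {m ∸ i} (fromℕ (suc i)) (λ k → coeff (suc i) (toℕ k) * x ^ toℕ k) ⟨
    fromℕ (suc i) * sum {m ∸ i} (λ k → coeff (suc i) (toℕ k) * x ^ toℕ k)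
      ≈⟨ *-cong (≈-refl {fromℕ (suc i)}) (sum-∸ m i (λ j → coeff (suc i) j * x ^ j)
           (λ m≤i → genStirling₁-coeff₀ x (s≤s m≤i))) ⟩
    fromℕ (suc i) * genStirling₁ m (suc i) x ∎)
  (remainder-+ {λ _ → coeff i 0 * 1ℝ} {λ y → sum {m ∸ i} (λ k → coeff i (suc (toℕ k)) * y ^ suc (toℕ k))}
    (remainder-const (coeff i 0 * 1ℝ) x)
    (remainder-sum {m ∸ i} (λ k y → coeff i (suc (toℕ k)) * y ^ suc (toℕ k))
      (λ k → coeff i (suc (toℕ k)) * (fromℕ (suc (toℕ k)) * x ^ toℕ k))
      (λ k → remainder-* (coeff i (suc (toℕ k))) {_^ suc (toℕ k)} (remainder-^ (toℕ k) x))))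
  where
  coeff : ℕ → ℕ → ℝ
  coeff = genStirling₁-coeff m
  term : ∀ j → coeff i (suc j) * (fromℕ (suc j) * x ^ j) ≈ fromℕ (suc i) * (coeff (suc i) j * x ^ j)
  -- Rewriting `j + suc i` as `suc (j + i)` gives both coefficients the same Stirling number, so
  -- that only the binomials differ, as in `C-shift`.
  term j rewrite ℕP.+-suc j i = begin
    fromℕ a * fromℕ s * (fromℕ (suc j) * x ^ j)
      ≈⟨ (pointwise λ k → eq (seq (fromℕ a) k) (seq (fromℕ s) k) (seq (fromℕ (suc j)) k) (seq (x ^ j) k)) ⟩
    fromℕ (suc j) * fromℕ a * (fromℕ s * x ^ j)
      ≈⟨ *-cong (≈-trans (≈-sym (×1-homo-* (suc j) a))
           (≈-trans (fromℕ-cong (≡.sym (C-shift j i))) (×1-homo-* (suc i) b))) ≈-refl ⟩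
    fromℕ (suc i) * fromℕ b * (fromℕ s * x ^ j)
      ≈⟨ (pointwise λ k → eq′ (seq (fromℕ (suc i)) k) (seq (fromℕ b) k) (seq (fromℕ s) k) (seq (x ^ j) k)) ⟩
    fromℕ (suc i) * (fromℕ b * fromℕ s * x ^ j) ∎
    where
    a = (suc j ℕ.+ i) C i
    b = (suc j ℕ.+ i) C suc i
    s = stirling₁ m (suc j ℕ.+ i)
    eq : ∀ a s j p → a ℚ.* s ℚ.* (j ℚ.* p) ≡ j ℚ.* a ℚ.* (s ℚ.* p)
    eq = solve-∀ ℚ-solverRing
    eq′ : ∀ i b s p → i ℚ.* b ℚ.* (s ℚ.* p) ≡ i ℚ.* (b ℚ.* s ℚ.* p)
    eq′ = solve-∀ ℚ-solverRing

-- The weights depend neither on i nor on x, so leaving them arbitrary lets one differentiation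
-- serve both kinds.
stirlingSum : (ℕ → ℝ) → ℕ → ℕ → ℝ → ℝ
stirlingSum w n i x = fromℕ (i !) * ∑ i n (λ m → w m * genStirling₁ m i x)

stirlingSum-remainder : ∀ w n i x →
  QuadraticRemainder (stirlingSum w n i) (stirlingSum w n (suc i) x) x
stirlingSum-remainder w n i x = remainder-cong {stirlingSum w n i} (λ _ → ≈-refl) (begin
    fromℕ (i !) * ∑ i n (λ m → w m * (fromℕ (suc i) * genStirling₁ m (suc i) x))
      ≈⟨ *-cong (≈-refl {fromℕ (i !)}) (sum-cong-≋ {suc n ∸ i} (λ k → pointwise λ l →
           eq (seq (w (i ℕ.+ toℕ k)) l) (seq (fromℕ (suc i)) l)
              (seq (genStirling₁ (i ℕ.+ toℕ k) (suc i) x) l))) ⟩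
    fromℕ (i !) * ∑ i n (λ m → fromℕ (suc i) * (w m * genStirling₁ m (suc i) x))
      ≈⟨ *-cong (≈-refl {fromℕ (i !)}) (*-distribˡ-sum {suc n ∸ i} (fromℕ (suc i))
           (λ k → w (i ℕ.+ toℕ k) * genStirling₁ (i ℕ.+ toℕ k) (suc i) x)) ⟨
    fromℕ (i !) * (fromℕ (suc i) * ∑ i n (λ m → w m * genStirling₁ m (suc i) x))
      ≈⟨ *-assoc (fromℕ (i !)) (fromℕ (suc i)) _ ⟨
    fromℕ (i !) * fromℕ (suc i) * ∑ i n (λ m → w m * genStirling₁ m (suc i) x)
      -- The factor i + 1 turns i! into (i + 1)!, and the term m = i drops out since [i,i+1]_x = 0.
      ≈⟨ *-cong (≈-trans (*-comm (fromℕ (i !)) (fromℕ (suc i))) (≈-sym (×1-homo-* (suc i) (i !))))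
           (∑-drop i n (λ m → w m * genStirling₁ m (suc i) x) first) ⟩
    stirlingSum w n (suc i) x ∎)
  (remainder-* (fromℕ (i !)) {λ y → ∑ i n (λ m → w m * genStirling₁ m i y)}
    (remainder-sum {suc n ∸ i} (λ k y → w (i ℕ.+ toℕ k) * genStirling₁ (i ℕ.+ toℕ k) i y)
      (λ k → w (i ℕ.+ toℕ k) * (fromℕ (suc i) * genStirling₁ (i ℕ.+ toℕ k) (suc i) x))
      (λ k → remainder-* (w (i ℕ.+ toℕ k)) {genStirling₁ (i ℕ.+ toℕ k) i}
        (genStirling₁-remainder (i ℕ.+ toℕ k) i x))))
  where
  eq : ∀ w i g → w ℚ.* (i ℚ.* g) ≡ i ℚ.* (w ℚ.* g)
  eq = solve-∀ ℚ-solverRing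
  first : w i * genStirling₁ i (suc i) x ≈ 0ℝ
  first = ≈-trans (*-cong (≈-refl {w i}) (genStirling₁-zero x (ℕP.n<1+n i))) (ℝ-Ring.zeroʳ (w i))

-- Vandermonde's convolution

-- Pascal's recursion unfolds both arguments of g without subtraction, so that
-- Vandermonde's identity becomes a direct induction.
pascal : ℕ → (ℕ → ℕ → ℝ) → ℝ
pascal zero    g = g 0 0
pascal (suc n) g = pascal n (λ p q → g (suc p) q) + pascal n (λ p q → g p (suc q))

pascal-cong : ∀ n {g h} → (∀ p q → g p q ≈ h p q) → pascal n g ≈ pascal n h
pascal-cong zero    e = e 0 0
pascal-cong (suc n) e = +-cong (pascal-cong n (λ p q → e (suc p) q)) (pascal-cong n (λ p q → e p (suc q)))

*-pascal : ∀ n c g → c * pascal n g ≈ pascal n (λ p q → c * g p q)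
*-pascal zero    c g = ≈-refl
*-pascal (suc n) c g = ≈-trans
  (*-distribˡ-+ c (pascal n (λ p q → g (suc p) q)) (pascal n (λ p q → g p (suc q))))
  (+-cong (*-pascal n c (λ p q → g (suc p) q)) (*-pascal n c (λ p q → g p (suc q))))

pascal-integral : ∀ n {g : ℝ → ℕ → ℕ → ℝ} {I a b} → (∀ p q → HasIntegral (λ t → g t p q) a b (I p q)) →
  HasIntegral (λ t → pascal n (g t)) a b (pascal n I)
pascal-integral zero    h = h 0 0
pascal-integral (suc n) h =
  integral-+ (pascal-integral n (λ p q → h (suc p) q)) (pascal-integral n (λ p q → h p (suc q)))

-- All terms past k = n vanish; leaving N free lets the induction split off heads
-- without correcting the last term. The same holds for stirling₁-sum below.
pascal-sum : ∀ n N (g : ℕ → ℕ → ℝ) → n ℕ.< N →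
  sum {N} (λ k → fromℕ (n C toℕ k) * g (n ∸ toℕ k) (toℕ k)) ≈ pascal n g
pascal-sum zero (suc N) g _ = ≈-trans
  (+-cong (pointwise λ k → eq (seq (g 0 0) k)) (sum-zero {N} (λ i → ≈-trans
    (*-cong (fromℕ-cong (k>n⇒nCk≡0 {0} {suc (toℕ i)} (s≤s z≤n))) (≈-refl {g 0 (suc (toℕ i))}))
    (ℝ-Ring.zeroˡ (g 0 (suc (toℕ i)))))))
  (+-identityʳ (g 0 0))
  where
  eq : ∀ a → (1ℚ ℚ.+ 0ℚ) ℚ.* a ≡ a
  eq = solve-∀ ℚ-solverRing
pascal-sum (suc n) (suc N) g (s≤s n<N) = begin
    head + sum {N} (λ k → fromℕ (suc n C suc (toℕ k)) * h (toℕ k))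
      ≈⟨ +-cong (≈-refl {head}) (sum-cong-≋ {N} (λ k → pascalRule (toℕ k))) ⟩
    head + sum {N} (λ k → fromℕ (n C toℕ k) * h (toℕ k) + fromℕ (n C suc (toℕ k)) * h (toℕ k))
      ≈⟨ +-cong (≈-refl {head}) (∑-distrib-+ {N}
           (λ k → fromℕ (n C toℕ k) * h (toℕ k)) (λ k → fromℕ (n C suc (toℕ k)) * h (toℕ k))) ⟩
    head + (A + B)
      -- `head + B` becomes the sum for n with p raised, and `A` is the sum for n with q raised;
      -- their lengths `suc N` and `N` both exceed n.
      ≈⟨ (pointwise λ k → eq (seq head k) (seq A k) (seq B k)) ⟩
    (head + B) + A
      ≈⟨ +-cong (+-cong (≈-refl {head}) (sum-cong-≋ {N} (λ k → lower (toℕ k)))) ≈-refl ⟩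
    sum {suc N} (λ k → fromℕ (n C toℕ k) * g (suc (n ∸ toℕ k)) (toℕ k)) + A
      ≈⟨ +-cong (pascal-sum n (suc N) (λ p q → g (suc p) q) (ℕP.m<n⇒m<1+n n<N))
               (pascal-sum n N (λ p q → g p (suc q)) n<N) ⟩
    pascal (suc n) g ∎
  where
  eq : ∀ h a b → h ℚ.+ (a ℚ.+ b) ≡ (h ℚ.+ b) ℚ.+ a
  eq = solve-∀ ℚ-solverRing
  h : ℕ → ℝ
  h k = g (n ∸ k) (suc k)
  head A B : ℝ
  head = fromℕ (suc n C 0) * g (suc n) 0
  A = sum {N} (λ k → fromℕ (n C toℕ k) * h (toℕ k))
  B = sum {N} (λ k → fromℕ (n C suc (toℕ k)) * h (toℕ k))
  pascalRule : ∀ k → fromℕ (suc n C suc k) * h k ≈ fromℕ (n C k) * h k + fromℕ (n C suc k) * h k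
  pascalRule k = ≈-trans
    (*-cong (≈-trans (fromℕ-cong (≡.sym (nCk+nC[k+1]≡[n+1]C[k+1] n k)))
      (×-homo-+ 1ℝ (n C k) (n C suc k))) (≈-refl {h k}))
    (*-distribʳ-+ (h k) (fromℕ (n C k)) (fromℕ (n C suc k)))
  -- For k < n the two first arguments of g agree. Otherwise the subtraction is truncated, but the
  -- binomial coefficient is 0.
  lower : ∀ k → fromℕ (n C suc k) * h k ≈ fromℕ (n C suc k) * g (suc (n ∸ suc k)) (suc k)
  lower k with suc k ℕP.≤? n
  ... | yes k<n = *-cong (≈-refl {fromℕ (n C suc k)})
    (ℝ-Ring.reflexive (≡.cong (λ p → g p (suc k)) (ℕP.+-∸-assoc 1 k<n)))
  ... | no  k≮n = ≈-trans (vanish (h k)) (≈-sym (vanish (g (suc (n ∸ suc k)) (suc k))))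
    where
    vanish : ∀ x → fromℕ (n C suc k) * x ≈ 0ℝ
    vanish x = ≈-trans (*-cong (fromℕ-cong (k>n⇒nCk≡0 (ℕP.≰⇒> k≮n))) (≈-refl {x})) (ℝ-Ring.zeroˡ x)

fallingFactorial-cong : ∀ {a b} → a ≈ b → ∀ n → fallingFactorial a n ≈ fallingFactorial b n
fallingFactorial-cong e zero    = ≈-refl
fallingFactorial-cong e (suc n) = *-cong (fallingFactorial-cong e n) (+-cong e ≈-refl)

-- The definition splits off the last factor; the induction for Vandermonde needs the first.
fallingFactorial-suc : ∀ z n → fallingFactorial z (suc n) ≈ z * fallingFactorial (z - 1ℝ) n
fallingFactorial-suc z zero = pointwise λ k → eq (seq z k)
  where
  eq : ∀ z → 1ℚ ℚ.* (z ℚ.- 0ℚ) ≡ z ℚ.* 1ℚ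
  eq = solve-∀ ℚ-solverRing
fallingFactorial-suc z (suc n) = ≈-trans
  (*-cong (fallingFactorial-suc z n) (≈-refl {z - fromℕ (suc n)}))
  (pointwise λ k → eq (seq z k) (seq (fallingFactorial (z - 1ℝ) n) k) (seq (fromℕ n) k))
  where
  eq : ∀ z f n → z ℚ.* f ℚ.* (z ℚ.- (1ℚ ℚ.+ n)) ≡ z ℚ.* (f ℚ.* ((z ℚ.- 1ℚ) ℚ.- n))
  eq = solve-∀ ℚ-solverRing

-- The first factor a + b is split. With a, the remaining product is expanded at (a - 1) + b and a
-- raises p; with b, at a + (b - 1) and b raises q. These are the two branches of `pascal`.
vandermonde : ∀ n a b →
  fallingFactorial (a + b) n ≈ pascal n (λ p q → fallingFactorial a p * fallingFactorial b q)
vandermonde zero    a b = ≈-sym (*-identityˡ 1ℝ)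
vandermonde (suc n) a b = begin
    F (a + b) (suc n)
      ≈⟨ fallingFactorial-suc (a + b) n ⟩
    (a + b) * F (a + b - 1ℝ) n
      ≈⟨ *-distribʳ-+ (F (a + b - 1ℝ) n) a b ⟩
    a * F (a + b - 1ℝ) n + b * F (a + b - 1ℝ) n
      ≈⟨ +-cong (*-cong (≈-refl {a}) (≈-trans
             (fallingFactorial-cong (pointwise λ k → eq₁ (seq a k) (seq b k)) n) (vandermonde n (a - 1ℝ) b)))
           (*-cong (≈-refl {b}) (≈-trans
             (fallingFactorial-cong (pointwise λ k → eq₂ (seq a k) (seq b k)) n) (vandermonde n a (b - 1ℝ)))) ⟩
    a * pascal n (λ p q → F (a - 1ℝ) p * F b q) + b * pascal n (λ p q → F a p * F (b - 1ℝ) q)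
      ≈⟨ +-cong
           (≈-trans (*-pascal n a (λ p q → F (a - 1ℝ) p * F b q)) (pascal-cong n (λ p q → ≈-trans
             (≈-sym (*-assoc a (F (a - 1ℝ) p) (F b q)))
             (*-cong (≈-sym (fallingFactorial-suc a p)) ≈-refl))))
           (≈-trans (*-pascal n b (λ p q → F a p * F (b - 1ℝ) q)) (pascal-cong n (λ p q → ≈-trans
             (pointwise λ k → eq₃ (seq b k) (seq (F a p) k) (seq (F (b - 1ℝ) q) k))
             (*-cong (≈-refl {F a p}) (≈-sym (fallingFactorial-suc b q)))))) ⟩
    pascal (suc n) (λ p q → F a p * F b q) ∎
  where
  F = fallingFactorial
  eq₁ : ∀ a b → a ℚ.+ b ℚ.- 1ℚ ≡ (a ℚ.- 1ℚ) ℚ.+ b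
  eq₁ = solve-∀ ℚ-solverRing
  eq₂ : ∀ a b → a ℚ.+ b ℚ.- 1ℚ ≡ a ℚ.+ (b ℚ.- 1ℚ)
  eq₂ = solve-∀ ℚ-solverRing
  eq₃ : ∀ b u v → b ℚ.* (u ℚ.* v) ≡ u ℚ.* (b ℚ.* v)
  eq₃ = solve-∀ ℚ-solverRing

-- Falling factorials through Stirling numbers

stirling₁-sum : ∀ m N x → m ℕ.< N →
  fallingFactorial (- x) m ≈ (- 1ℝ) ^ m * sum {N} (λ k → fromℕ (stirling₁ m (toℕ k)) * x ^ toℕ k)
stirling₁-sum zero (suc N) x _ = ≈-sym (≈-trans
  (*-identityˡ _)
  (≈-trans (+-cong (pointwise λ _ → ≡.refl) (sum-zero {N} (λ k → ℝ-Ring.zeroˡ (x ^ suc (toℕ k)))))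
  (+-identityʳ 1ℝ)))
stirling₁-sum (suc m) (suc N) x (s≤s m<N) = begin
    F m * (- x - fromℕ m)
      -- The summands with m and x yield the two terms of the recursion for `stirling₁ (suc m)`.
      ≈⟨ (pointwise λ k → eq (seq (F m) k) (seq x k) (seq (fromℕ m) k)) ⟩
    - 1ℝ * (fromℕ m * F m + x * F m)
      ≈⟨ *-cong (≈-refl { - 1ℝ}) (+-cong
           -- Length `suc N` exposes the constant term; multiplication by x raises every exponent,
           -- so the other summand takes length `N`.
           (*-cong (≈-refl {fromℕ m}) (stirling₁-sum m (suc N) x (ℕP.m<n⇒m<1+n m<N)))
           (*-cong (≈-refl {x}) (stirling₁-sum m N x m<N))) ⟩
    - 1ℝ * (fromℕ m * (ε * (fromℕ (stirling₁ m 0) * 1ℝ + A)) + x * (ε * B))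
      ≈⟨ (pointwise λ k → eq′ (seq ε k) (seq (fromℕ m) k) (seq (fromℕ (stirling₁ m 0)) k)
           (seq x k) (seq A k) (seq B k)) ⟩
    - 1ℝ * ε * (fromℕ m * fromℕ (stirling₁ m 0) + (fromℕ m * A + x * B))
      ≈⟨ *-cong (≈-refl { - 1ℝ * ε}) (+-cong
           (≈-trans (≈-sym (×1-homo-* m (stirling₁ m 0))) (fromℕ-cong (m*stirling₁[m,0] m)))
           (≈-trans (+-cong
             (*-distribˡ-sum {N} (fromℕ m) (λ k → fromℕ (stirling₁ m (suc (toℕ k))) * x ^ suc (toℕ k)))
             (*-distribˡ-sum {N} x (λ k → fromℕ (stirling₁ m (toℕ k)) * x ^ toℕ k)))
           (≈-trans (≈-sym (∑-distrib-+ {N}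
             (λ k → fromℕ m * (fromℕ (stirling₁ m (suc (toℕ k))) * x ^ suc (toℕ k)))
             (λ k → x * (fromℕ (stirling₁ m (toℕ k)) * x ^ toℕ k))))
           (sum-cong-≋ {N} (λ k → term (toℕ k)))))) ⟩
    - 1ℝ * ε * (0ℝ + S)
      ≈⟨ *-cong (≈-refl { - 1ℝ * ε}) (+-cong (≈-sym (*-identityʳ 0ℝ)) (≈-refl {S})) ⟩
    - 1ℝ * ε * (0ℝ * 1ℝ + S) ∎
  where
  F = fallingFactorial (- x)
  ε A B S : ℝ
  ε = (- 1ℝ) ^ m
  A = sum {N} (λ k → fromℕ (stirling₁ m (suc (toℕ k))) * x ^ suc (toℕ k))
  B = sum {N} (λ k → fromℕ (stirling₁ m (toℕ k)) * x ^ toℕ k)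
  S = sum {N} (λ k → fromℕ (stirling₁ (suc m) (suc (toℕ k))) * x ^ suc (toℕ k))
  eq : ∀ f x m → f ℚ.* ((ℚ.- x) ℚ.- m) ≡ (ℚ.- 1ℚ) ℚ.* (m ℚ.* f ℚ.+ x ℚ.* f)
  eq = solve-∀ ℚ-solverRing
  eq′ : ∀ e m s x a b → (ℚ.- 1ℚ) ℚ.* (m ℚ.* (e ℚ.* (s ℚ.* 1ℚ ℚ.+ a)) ℚ.+ x ℚ.* (e ℚ.* b))
        ≡ (ℚ.- 1ℚ) ℚ.* e ℚ.* (m ℚ.* s ℚ.+ (m ℚ.* a ℚ.+ x ℚ.* b))
  eq′ = solve-∀ ℚ-solverRing
  m*stirling₁[m,0] : ∀ m → m ℕ.* stirling₁ m 0 ≡ 0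
  m*stirling₁[m,0] zero    = ≡.refl
  m*stirling₁[m,0] (suc m) = ℕP.*-zeroʳ (suc m)
  term : ∀ j → fromℕ m * (fromℕ (stirling₁ m (suc j)) * x ^ suc j) + x * (fromℕ (stirling₁ m j) * x ^ j)
               ≈ fromℕ (stirling₁ (suc m) (suc j)) * x ^ suc j
  term j = ≈-trans
    (pointwise λ k → eq″ (seq (fromℕ m) k) (seq (fromℕ a) k) (seq (fromℕ b) k) (seq x k) (seq (x ^ j) k))
    (*-cong (≈-sym (≈-trans (×-homo-+ 1ℝ (m ℕ.* a) b) (+-cong (×1-homo-* m a) ≈-refl))) ≈-refl)
    where
    a = stirling₁ m (suc j)
    b = stirling₁ m j
    eq″ : ∀ m a b x p → m ℚ.* (a ℚ.* (x ℚ.* p)) ℚ.+ x ℚ.* (b ℚ.* p) ≡ (m ℚ.* a ℚ.+ b) ℚ.* (x ℚ.* p)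
    eq″ = solve-∀ ℚ-solverRing

fallingFactorial-genStirling₁ : ∀ m {x y} → y ≈ - x → fallingFactorial y m ≈ (- 1ℝ) ^ m * genStirling₁ m 0 x
fallingFactorial-genStirling₁ m {x} {y} y≈-x = begin
    fallingFactorial y m
      ≈⟨ fallingFactorial-cong y≈-x m ⟩
    fallingFactorial (- x) m
      ≈⟨ stirling₁-sum m (suc m) x (ℕP.n<1+n m) ⟩
    (- 1ℝ) ^ m * sum {suc m} (λ k → fromℕ (stirling₁ m (toℕ k)) * x ^ toℕ k)
      ≈⟨ *-cong (≈-refl {(- 1ℝ) ^ m}) (sum-cong-≋ {suc m} (λ k → term (toℕ k))) ⟩
    (- 1ℝ) ^ m * genStirling₁ m 0 x ∎
  where
  term : ∀ j → fromℕ (stirling₁ m j) * x ^ j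
               ≈ fromℕ ((j ℕ.+ 0) C 0) * fromℕ (stirling₁ m (j ℕ.+ 0)) * x ^ j
  term j = *-cong (≈-sym (≈-trans (pointwise λ k → eq (seq (fromℕ (stirling₁ m (j ℕ.+ 0))) k))
    (fromℕ-cong (≡.cong (stirling₁ m) (ℕP.+-identityʳ j))))) ≈-refl
    where
    eq : ∀ a → (1ℚ ℚ.+ 0ℚ) ℚ.* a ≡ a
    eq = solve-∀ ℚ-solverRing

-- Cauchy polynomials through Cauchy numbers

factorial-binom : ∀ n z → fromℕ (n !) * binom z n ≈ fallingFactorial z n
factorial-binom n z = begin
    fromℕ (n !) * (fallingFactorial z n * 1/ n !)
      ≈⟨ (pointwise λ k → eq (seq (fromℕ (n !)) k) (seq (fallingFactorial z n) k) (seq (1/ n !) k)) ⟩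
    fallingFactorial z n * (fromℕ (n !) * 1/ n !)
      ≈⟨ *-cong (≈-refl {fallingFactorial z n}) (fromℕ*1/n≈1 (n !) {{ℕP._!≢0 n}}) ⟩
    fallingFactorial z n * 1ℝ
      ≈⟨ *-identityʳ (fallingFactorial z n) ⟩
    fallingFactorial z n ∎
  where
  eq : ∀ a b c → a ℚ.* (b ℚ.* c) ≡ b ℚ.* (a ℚ.* c)
  eq = solve-∀ ℚ-solverRing

c-integral : ∀ n x → HasIntegral (λ t → fallingFactorial (t - x) n) 0ℝ 1ℝ (c n x)
c-integral n x = integral-cong (λ t → factorial-binom n (t - x))
  (integral-* (fromℕ (n !)) (proj₂ (integrable₁ n x)))

ĉ-integral : ∀ n x → HasIntegral (λ t → fallingFactorial (x - t) n) 0ℝ 1ℝ (ĉ n x)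
ĉ-integral n x = integral-cong (λ t → factorial-binom n (x - t))
  (integral-* (fromℕ (n !)) (proj₂ (integrable₂ n x)))

cauchyWeight : (ℕ → ℝ) → ℕ → ℕ → ℝ
cauchyWeight I n m = (- 1ℝ) ^ m * I (n ∸ m) * fromℕ (n C m)

-- Stated for both kinds at once: u t is t - 0 or 0 - t, and y is the shift - x or x, with `x`
-- standing for its negative. The falling factorials of y are constant in t and leave the integral.
integral-translate : ∀ n {v u : ℝ → ℝ} {x y I J} → (∀ t → u t + y ≈ v t) → y ≈ - x →
  (∀ p → HasIntegral (λ t → fallingFactorial (u t) p) 0ℝ 1ℝ (I p)) →
  HasIntegral (λ t → fallingFactorial (v t) n) 0ℝ 1ℝ J →
  J ≈ stirlingSum (cauchyWeight I n) n 0 x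
integral-translate n {v} {u} {x} {y} {I} {J} u+y≈v y≈-x hI hJ = begin
    J
      ≈⟨ integral-unique hJ (integral-cong
           (λ t → ≈-trans (≈-sym (vandermonde n (u t) y)) (fallingFactorial-cong (u+y≈v t) n))
           (pascal-integral n (λ p q → integral-cong
             (λ t → *-comm (F y q) (F (u t) p)) (integral-* (F y q) (hI p))))) ⟩
    pascal n (λ p q → F y q * I p)
      ≈⟨ pascal-sum n (suc n) (λ p q → F y q * I p) (ℕP.n<1+n n) ⟨
    sum {suc n} (λ k → fromℕ (n C toℕ k) * (F y (toℕ k) * I (n ∸ toℕ k)))
      ≈⟨ sum-cong-≋ {suc n} (λ k → term (toℕ k)) ⟩
    ∑ 0 n (λ m → cauchyWeight I n m * genStirling₁ m 0 x)
      ≈⟨ *-identityˡ _ ⟨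
    1ℝ * ∑ 0 n (λ m → cauchyWeight I n m * genStirling₁ m 0 x)
      -- `fromℕ (0 !)` unfolds to `1ℝ + 0ℝ`.
      ≈⟨ *-cong (≈-sym (+-identityʳ 1ℝ)) ≈-refl ⟩
    stirlingSum (cauchyWeight I n) n 0 x ∎
  where
  F = fallingFactorial
  term : ∀ m → fromℕ (n C m) * (F y m * I (n ∸ m)) ≈ cauchyWeight I n m * genStirling₁ m 0 x
  term m = ≈-trans
    (*-cong (≈-refl {fromℕ (n C m)}) (*-cong (fallingFactorial-genStirling₁ m y≈-x) (≈-refl {I (n ∸ m)})))
    (pointwise λ k → eq (seq (fromℕ (n C m)) k) (seq ((- 1ℝ) ^ m) k)
      (seq (genStirling₁ m 0 x) k) (seq (I (n ∸ m)) k))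
    where
    eq : ∀ b e g i → b ℚ.* (e ℚ.* g ℚ.* i) ≡ e ℚ.* i ℚ.* b ℚ.* g
    eq = solve-∀ ℚ-solverRing

-- Iterated derivatives

iterated : ∀ {f} (D : ℕ → ℝ → ℝ) → (∀ x → f x ≈ D 0 x) →
  (∀ i x → HasDerivativeAt (D i) (D (suc i) x) x) → ∀ i → IsIteratedDerivative i f (D i)
iterated D f≈D₀ D′ zero    = f≈D₀
iterated D f≈D₀ D′ (suc i) = D i , iterated D f≈D₀ D′ i , D′ i

theorem6 : ∀ (n i : ℕ) →
    IsIteratedDerivative i (c n)
    (λ x → fromℕ (i !) * ∑ i n (λ m → (- 1ℝ) ^ m * c (n ∸ m) 0ℝ * fromℕ (n C m) * genStirling₁ m i x))
    ×
    IsIteratedDerivative i (ĉ n)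
    (λ x → (- 1ℝ) ^ i * fromℕ (i !) * ∑ i n (λ m → (- 1ℝ) ^ m * ĉ (n ∸ m) 0ℝ * fromℕ (n C m) * genStirling₁ m i (- x)))
theorem6 n i =
    iterated (stirlingSum w n)
      (λ x → integral-translate n {λ t → t - x} {λ t → t - 0ℝ} {x} { - x}
        (λ t → pointwise λ k → eq₁ (seq t k) (seq x k)) ≈-refl (λ p → c-integral p 0ℝ) (c-integral n x))
      (λ i x → quadraticRemainder⇒derivative {stirlingSum w n i} (stirlingSum-remainder w n i x)) i
  , iterated D
      (λ x → ≈-trans
        (integral-translate n {λ t → x - t} {λ t → 0ℝ - t} { - x} {x}
          (λ t → pointwise λ k → eq₂ (seq t k) (seq x k)) (pointwise λ k → eq₃ (seq x k))
          (λ p → ĉ-integral p 0ℝ) (ĉ-integral n x))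
        (*-cong (≈-sym (*-identityˡ (fromℕ 1))) ≈-refl))
      (λ i x → quadraticRemainder⇒derivative {D i} (D-remainder i x)) i
  where
  w ŵ : ℕ → ℝ
  w = cauchyWeight (λ p → c p 0ℝ) n
  ŵ = cauchyWeight (λ p → ĉ p 0ℝ) n
  D : ℕ → ℝ → ℝ
  D i x = (- 1ℝ) ^ i * fromℕ (i !) * ∑ i n (λ m → ŵ m * genStirling₁ m i (- x))
  eq₁ : ∀ t x → (t ℚ.- 0ℚ) ℚ.+ (ℚ.- x) ≡ t ℚ.- x
  eq₁ = solve-∀ ℚ-solverRing
  eq₂ : ∀ t x → (0ℚ ℚ.- t) ℚ.+ x ≡ x ℚ.- t
  eq₂ = solve-∀ ℚ-solverRing
  eq₃ : ∀ x → x ≡ ℚ.- (ℚ.- x)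
  eq₃ = solve-∀ ℚ-solverRing
  eq₄ : ∀ e f s → e ℚ.* (ℚ.- (f ℚ.* s)) ≡ (ℚ.- 1ℚ) ℚ.* e ℚ.* f ℚ.* s
  eq₄ = solve-∀ ℚ-solverRing
  -- The inner function x ↦ - x contributes one sign per differentiation, turning (-1)^i into
  -- (-1)^(i+1).
  D-remainder : ∀ i x → QuadraticRemainder (D i) (D (suc i) x) x
  D-remainder i x = remainder-cong {λ y → (- 1ℝ) ^ i * stirlingSum ŵ n i (- y)}
    (λ y → ≈-sym (*-assoc ((- 1ℝ) ^ i) (fromℕ (i !)) (∑ i n (λ m → ŵ m * genStirling₁ m i (- y)))))
    (pointwise λ k → eq₄ (seq ((- 1ℝ) ^ i) k) (seq (fromℕ (suc i !)) k)
      (seq (∑ (suc i) n (λ m → ŵ m * genStirling₁ m (suc i) (- x))) k))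
    (remainder-* ((- 1ℝ) ^ i) {λ y → stirlingSum ŵ n i (- y)}
      (remainder-∘neg {stirlingSum ŵ n i} (stirlingSum-remainder ŵ n i (- x))))
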